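{- There exist a constant $c>0$ and a positive integer $k_0$ such that for every integer $k\ge k_0$ there is a $k$-permutation $\pi$ with $$L(\pi)\ \ge\ 2^{c\,k^{1/4}}.$$
   Context: Write $[n]=\{1,\dots,n\}$. An $n$-permutation is a permutation of $[n]$. An $n$-permutation $\sigma$ contains a $k$-permutation $\pi$ if there are integers $1\le x_1<x_2<\dots<x_k\le n$ such that for all $1\le i,j\le k$ we have $\sigma(x_i)<\sigma(x_j)$ if and only if $\pi(i)<\pi(j)$; otherwise $\sigma$ avoids $\pi$. $S_n(\pi)$ denotes the number of $n$-permutations that avoid $\pi$. The Stanley-Wilf limit of $\pi$ is $L(\pi)=\lim_{n\to\infty}S_n(\pi)^{1/n}$, which is known to exist and be finite for every permutation $\pi$ (Marcus-Tardos, Arratia). -}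

module Defs where

open import Algebra.Bundles using (CommutativeRing)
open import Data.Fin.Base as Fin using (Fin; zero; suc; punchIn)
open import Data.Fin.Permutation using (Permutation′; _⟨$⟩ʳ_; _≈_; insert; remove; id; insert-remove)
open import Data.Fin.Properties as Fin using (all?; any?; punchIn-injective)
open import Data.Integer.Base as ℤ using (ℤ; +_; -[1+_])
import Data.Integer.Properties as ℤ
open import Data.List.Base using (List; []; _∷_; allFin; cartesianProductWith; filter; length)
open import Data.List.Membership.Propositional.Properties using (∈-allFin)
open import Data.List.Relation.Unary.All using ([])
open import Data.List.Relation.Unary.AllPairs using ([]; _∷_)
open import Data.List.Relation.Unary.Any using (Any; here)
import Data.List.Relation.Unary.Any.Properties as Any
open import Data.List.Relation.Unary.Unique.Propositional.Properties using (allFin⁺)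
import Data.List.Relation.Unary.Unique.Setoid as SetoidUnique
import Data.List.Relation.Unary.Unique.Setoid.Properties as SetoidUnique
open import Data.Nat.Base as ℕ using (ℕ; zero; suc)
import Data.Nat.Properties as ℕ
open import Data.Product.Base using (_×_; _,_; ∃; ∃-syntax; proj₁; proj₂)
open import Data.Rational.Base
  using (ℚ; 0ℚ; 1ℚ; ½; _+_; _*_; _-_; -_; _<_; _≤_; _/_; 1/_; toℚᵘ; ↥_; ↧ₙ_; *<*;
         Positive; NonZero; positive; nonNegative; nonPositive)
open import Data.Rational.Properties as ℚ using (module ≤-Reasoning)
open import Data.Rational.Solver using (module +-*-Solver)
import Data.Rational.Unnormalised.Base as ℚᵘ
import Data.Rational.Unnormalised.Properties as ℚᵘ
open import Data.Sum.Base using (_⊎_; inj₁; inj₂)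
open import Data.Vec.Base using (Vec; []; _∷_; lookup; tabulate)
open import Data.Vec.Properties using (lookup∘tabulate)
open import Function.Base using (_∘_; case_of_)
open import Function.Bundles using (_⇔_; mk⇔; Equivalence)
open import Level using (0ℓ)
open import Relation.Binary.Bundles using (Setoid)
open import Relation.Binary.Definitions using (tri<; tri≈; tri>)
open import Relation.Binary.PropositionalEquality
  using (_≡_; _≗_; refl; sym; trans; cong; subst; subst₂)
open import Relation.Nullary.Decidable using (Dec; yes; no; ¬?; map′; _→-dec_; _×-dec_)
open import Relation.Nullary.Negation using (¬_; contradiction)

open import Algebra.Properties.Semiring.Exp (CommutativeRing.semiring ℚ.+-*-commutativeRing)
  using (_^_; ^-assocʳ)
open +-*-Solver using (solve; _:=_; _:+_; _:*_; :-_; _:-_; con)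

------------------------------------------------------------------------
-- Permutations and pattern avoidance

StrictlyIncreasing : ∀ {k n} → (Fin k → Fin n) → Set
StrictlyIncreasing x = ∀ i j → i Fin.< j → x i Fin.< x j

record Occurrence {k n} (π : Permutation′ k) (σ : Permutation′ n) (x : Fin k → Fin n) : Set where
  constructor occurrence
  field
    increasing : StrictlyIncreasing x
    same-order : ∀ i j → (σ ⟨$⟩ʳ x i Fin.< σ ⟨$⟩ʳ x j) ⇔ (π ⟨$⟩ʳ i Fin.< π ⟨$⟩ʳ j)

_Contains_ : ∀ {k n} → Permutation′ n → Permutation′ k → Set
σ Contains π = ∃ λ x → Occurrence π σ x

_Avoids_ : ∀ {k n} → Permutation′ n → Permutation′ k → Set
σ Avoids π = ¬ (σ Contains π)

private
  anyVec? : ∀ {n} k {P : Vec (Fin n) k → Set} → (∀ v → Dec (P v)) → Dec (∃ P)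
  anyVec? zero    P? = map′ ([] ,_) (λ { ([] , p) → p }) (P? [])
  anyVec? (suc k) P? = map′ (λ (a , v , p) → a ∷ v , p) (λ { (a ∷ v , p) → a , v , p })
    (any? λ a → anyVec? k λ v → P? (a ∷ v))

  occurrence? : ∀ {k n} (π : Permutation′ k) (σ : Permutation′ n) x → Dec (Occurrence π σ x)
  occurrence? π σ x = map′
    (λ (p , q) → occurrence p λ i j → mk⇔ (proj₁ (q i j)) (proj₂ (q i j)))
    (λ o → Occurrence.increasing o , λ i j →
       Equivalence.to (Occurrence.same-order o i j) , Equivalence.from (Occurrence.same-order o i j))
    (all? (λ i → all? λ j → i Fin.<? j →-dec x i Fin.<? x j)
     ×-dec all? λ i → all? λ j →
       (σ ⟨$⟩ʳ x i Fin.<? σ ⟨$⟩ʳ x j →-dec π ⟨$⟩ʳ i Fin.<? π ⟨$⟩ʳ j)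
       ×-dec (π ⟨$⟩ʳ i Fin.<? π ⟨$⟩ʳ j →-dec σ ⟨$⟩ʳ x i Fin.<? σ ⟨$⟩ʳ x j))

  occurrence-resp : ∀ {k n} {π : Permutation′ k} {σ : Permutation′ n} {x y} →
                    x ≗ y → Occurrence π σ x → Occurrence π σ y
  occurrence-resp {σ = σ} x≗y (occurrence p q) = occurrence
    (λ i j i<j → subst₂ Fin._<_ (x≗y i) (x≗y j) (p i j i<j))
    (λ i j → subst₂ (λ a b → (σ ⟨$⟩ʳ a Fin.< σ ⟨$⟩ʳ b) ⇔ _) (x≗y i) (x≗y j) (q i j))

_contains?_ : ∀ {k n} (σ : Permutation′ n) (π : Permutation′ k) → Dec (σ Contains π)
_contains?_ {k} σ π = map′
  (λ (v , o) → lookup v , o)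
  (λ (x , o) → tabulate x , occurrence-resp (sym ∘ lookup∘tabulate x) o)
  (anyVec? k λ v → occurrence? π σ (lookup v))

-- All permutations, by choosing the value at zero and a permutation of the rest.

permutations : ∀ n → List (Permutation′ n)
permutations zero    = id ∷ []
permutations (suc n) = cartesianProductWith (insert zero) (allFin (suc n)) (permutations n)

permutationSetoid : ℕ → Setoid 0ℓ 0ℓ
permutationSetoid n = record
  { Carrier       = Permutation′ n
  ; _≈_           = _≈_
  ; isEquivalence = record
    { refl  = λ _ → refl
    ; sym   = λ p i → sym (p i)
    ; trans = λ p q i → trans (p i) (q i)
    }
  }

-- Permutations are compared by their values, and each occurs exactly once in the
-- list, so the length of a filtered sublist is a count of permutations.

permutations-complete : ∀ {n} (σ : Permutation′ n) → Any (σ ≈_) (permutations n)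
permutations-complete {zero}  σ = here λ ()
permutations-complete {suc n} σ = Any.cartesianProductWith⁺ (insert zero)
  {P = (σ ⟨$⟩ʳ zero) ≡_} {Q = remove zero σ ≈_} {R = σ ≈_}
  (λ { {x} {ρ} refl r i → trans (sym (insert-remove zero σ i)) (insert-cong x (remove zero σ) ρ r i) })
  (∈-allFin (σ ⟨$⟩ʳ zero)) (permutations-complete (remove zero σ))
  where
  insert-cong : ∀ x (ρ τ : Permutation′ n) → ρ ≈ τ → insert zero x ρ ≈ insert zero x τ
  insert-cong x ρ τ r zero    = refl
  insert-cong x ρ τ r (suc i) = cong (punchIn x) (r i)

permutations-unique : ∀ n → SetoidUnique.Unique (permutationSetoid n) (permutations n)
permutations-unique zero    = [] ∷ []
permutations-unique (suc n) = SetoidUnique.cartesianProductWith⁺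
  (Fin.≡-setoid (suc n)) (permutationSetoid n) (permutationSetoid (suc n))
  (insert zero) (λ {x} {y} {ρ} {τ} → injective {x} {y} {ρ} {τ}) (allFin⁺ (suc n)) (permutations-unique n)
  where
  injective : ∀ {x y ρ τ} → insert zero x ρ ≈ insert zero y τ → x ≡ y × ρ ≈ τ
  injective {x} {y} {ρ} {τ} eq with eq zero
  ... | refl = refl , λ i → punchIn-injective x _ _ (eq (suc i))

avoidingPermutations : ∀ {k} → Permutation′ k → ∀ n → List (Permutation′ n)
avoidingPermutations π n = filter (λ σ → ¬? (σ contains? π)) (permutations n)

S : ∀ {k} → Permutation′ k → ℕ → ℕ
S π n = length (avoidingPermutations π n)

------------------------------------------------------------------------
-- Rational arithmetic

fromℕ : ℕ → ℚ
fromℕ n = + n / 1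

module RationalLemmas where

  fromℕ-suc : ∀ n → fromℕ (suc n) ≡ 1ℚ + fromℕ n
  fromℕ-suc n = ℚ.toℚᵘ-injective (begin
    toℚᵘ (fromℕ (suc n))          ≈⟨ ℚ.toℚᵘ-fromℚᵘ (ℚᵘ.mkℚᵘ (+ suc n) 0) ⟩
    ℚᵘ.mkℚᵘ (+ suc n) 0           ≈⟨ ℚᵘ.*≡* (cong (ℤ._* + 1) (sym (cong (λ i → + 1 ℤ.+ i) (ℤ.*-identityʳ (+ n))))) ⟩
    ℚᵘ.1ℚᵘ ℚᵘ.+ ℚᵘ.mkℚᵘ (+ n) 0   ≈⟨ ℚᵘ.+-congʳ ℚᵘ.1ℚᵘ (ℚ.toℚᵘ-fromℚᵘ (ℚᵘ.mkℚᵘ (+ n) 0)) ⟨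
    ℚᵘ.1ℚᵘ ℚᵘ.+ toℚᵘ (fromℕ n)    ≈⟨ ℚ.toℚᵘ-homo-+ 1ℚ (fromℕ n) ⟨
    toℚᵘ (1ℚ + fromℕ n)           ∎)
    where open ℚᵘ.≃-Reasoning

  /-mono-< : ∀ a b c d .{{_ : ℕ.NonZero b}} .{{_ : ℕ.NonZero d}} →
             a ℤ.* + d ℤ.< c ℤ.* + b → a / b < c / d
  /-mono-< a (suc b) c (suc d) lt = ℚ.toℚᵘ-cancel-<
    (ℚᵘ.<-respˡ-≃ (ℚᵘ.≃-sym (ℚ.toℚᵘ-fromℚᵘ (ℚᵘ.mkℚᵘ a b)))
    (ℚᵘ.<-respʳ-≃ (ℚᵘ.≃-sym (ℚ.toℚᵘ-fromℚᵘ (ℚᵘ.mkℚᵘ c d))) (ℚᵘ.*<* lt)))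

  /-cancel-< : ∀ a b c d .{{_ : ℕ.NonZero b}} .{{_ : ℕ.NonZero d}} →
               a / b < c / d → a ℤ.* + d ℤ.< c ℤ.* + b
  /-cancel-< a (suc b) c (suc d) lt = ℚᵘ.drop-*<*
    (ℚᵘ.<-respˡ-≃ (ℚ.toℚᵘ-fromℚᵘ (ℚᵘ.mkℚᵘ a b))
    (ℚᵘ.<-respʳ-≃ (ℚ.toℚᵘ-fromℚᵘ (ℚᵘ.mkℚᵘ c d)) (ℚ.toℚᵘ-mono-< lt)))

  ∣i∣<-bound : ∀ i d → i ℤ.* + 1 ℤ.< + suc ℤ.∣ i ∣ ℤ.* + suc d
  ∣i∣<-bound (+ n) d = subst₂ ℤ._<_ (sym (ℤ.*-identityʳ (+ n))) (ℤ.pos-* (suc n) (suc d))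
    (ℤ.+<+ (ℕ.m≤m*n (suc n) (suc d)))
  ∣i∣<-bound -[1+ n ] d = ℤ.-<+

  archimedean : ∀ r → ∃[ n ] r < fromℕ n
  archimedean r = suc ℤ.∣ ↥ r ∣ , ℚ.<-respˡ-≡ (ℚ.↥p/↧p≡p r)
    (/-mono-< (↥ r) (↧ₙ r) (+ suc ℤ.∣ ↥ r ∣) 1 (∣i∣<-bound (↥ r) _))

  0≤fromℕ : ∀ n → 0ℚ ≤ fromℕ n
  0≤fromℕ zero    = ℚ.≤-refl
  0≤fromℕ (suc n) = subst (0ℚ ≤_) (sym (fromℕ-suc n))
    (ℚ.+-mono-≤ {0ℚ} {1ℚ} (ℚ.nonNegative⁻¹ 1ℚ) (0≤fromℕ n))

  q<q+h : ∀ q {h} → 0ℚ < h → q < q + h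
  q<q+h q 0<h = ℚ.<-respˡ-≡ (ℚ.+-identityʳ q) (ℚ.+-monoʳ-< q 0<h)

  0<q-p : ∀ {p q} → p < q → 0ℚ < q - p
  0<q-p {p} {q} p<q = ℚ.<-respˡ-≡ (ℚ.+-inverseʳ p) (ℚ.+-monoˡ-< (- p) p<q)

  *-monoʳ-≤ : ∀ {r p q} → 0ℚ ≤ r → p ≤ q → r * p ≤ r * q
  *-monoʳ-≤ {r} 0≤r = ℚ.*-monoˡ-≤-nonNeg r {{nonNegative 0≤r}}

  *-monoˡ-≤ : ∀ {r p q} → 0ℚ ≤ r → p ≤ q → p * r ≤ q * r
  *-monoˡ-≤ {r} 0≤r = ℚ.*-monoʳ-≤-nonNeg r {{nonNegative 0≤r}}

  *-mono-≤ : ∀ {p q r s} → 0ℚ ≤ p → 0ℚ ≤ r → p ≤ q → r ≤ s → p * r ≤ q * s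
  *-mono-≤ 0≤p 0≤r p≤q r≤s =
    ℚ.≤-trans (*-monoˡ-≤ 0≤r p≤q) (*-monoʳ-≤ (ℚ.≤-trans 0≤p p≤q) r≤s)

  0<* : ∀ {p q} → 0ℚ < p → 0ℚ < q → 0ℚ < p * q
  0<* {p} {q} 0<p 0<q = ℚ.positive⁻¹ (p * q) {{ℚ.pos*pos⇒pos p {{positive 0<p}} q {{positive 0<q}}}}

  0≤* : ∀ {p q} → 0ℚ ≤ p → 0ℚ ≤ q → 0ℚ ≤ p * q
  0≤* {p} {q} 0≤p 0≤q = ℚ.nonNegative⁻¹ (p * q) {{ℚ.nonNeg*nonNeg⇒nonNeg p {{nonNegative 0≤p}} q {{nonNegative 0≤q}}}}

  archimedean* : ∀ {h} → 0ℚ < h → ∀ r → ∃[ n ] r < fromℕ n * h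
  archimedean* {h} 0<h r = case archimedean (r * 1/ h) of λ (n , lt) → n , clear n lt
    where
    instance
      h⁺ : Positive h
      h⁺ = positive 0<h
      h≢0 : NonZero h
      h≢0 = ℚ.pos⇒nonZero h
    clear : ∀ n → r * 1/ h < fromℕ n → r < fromℕ n * h
    clear n lt = subst (_< fromℕ n * h)
      (trans (ℚ.*-assoc r (1/ h) h) (trans (cong (r *_) (ℚ.*-inverseˡ h)) (ℚ.*-identityʳ r)))
      (ℚ.*-monoˡ-<-pos h lt)

  small-step : ∀ {A ε N k} → 0ℚ < ε → 0ℚ ≤ k → N ≡ 1ℚ + k → A < k * ε →
               ∃[ δ ] 0ℚ < δ × δ ≤ 1ℚ × A * δ < ε
  small-step {A} {ε} {N} {k} 0<ε 0≤k N≡ A<kε = δ , 0<δ , δ≤1 , Aδ<ε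
    where
    0<N : 0ℚ < N
    0<N = subst (0ℚ <_) (sym N≡) (ℚ.+-mono-<-≤ {0ℚ} {1ℚ} (ℚ.positive⁻¹ 1ℚ) 0≤k)
    1≤N : 1ℚ ≤ N
    1≤N = subst₂ _≤_ (ℚ.+-identityʳ 1ℚ) (sym N≡) (ℚ.+-monoʳ-≤ 1ℚ 0≤k)
    k≤N : k ≤ N
    k≤N = subst₂ _≤_ (ℚ.+-identityˡ k) (sym N≡) (ℚ.+-monoˡ-≤ k (ℚ.nonNegative⁻¹ 1ℚ))
    instance
      N⁺ : Positive N
      N⁺ = positive 0<N
      N≢0 : NonZero N
      N≢0 = ℚ.pos⇒nonZero N
    δ : ℚ
    δ = 1/ N
    instance
      δ⁺ : Positive δ
      δ⁺ = ℚ.1/pos⇒pos N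
    0<δ : 0ℚ < δ
    0<δ = ℚ.positive⁻¹ δ
    δ≤1 : δ ≤ 1ℚ
    δ≤1 = subst₂ _≤_ (ℚ.*-identityˡ δ) (ℚ.*-inverseʳ N) (*-monoˡ-≤ (ℚ.<⇒≤ 0<δ) 1≤N)
    Aδ<ε : A * δ < ε
    Aδ<ε = begin-strict
      A * δ            <⟨ ℚ.*-monoˡ-<-pos δ A<kε ⟩
      k * ε * δ        ≤⟨ *-monoˡ-≤ (ℚ.<⇒≤ 0<δ) (*-monoˡ-≤ (ℚ.<⇒≤ 0<ε) k≤N) ⟩
      N * ε * δ        ≡⟨ cong (_* δ) (ℚ.*-comm N ε) ⟩
      ε * N * δ        ≡⟨ ℚ.*-assoc ε N δ ⟩
      ε * (N * δ)      ≡⟨ cong (ε *_) (ℚ.*-inverseʳ N) ⟩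
      ε * 1ℚ           ≡⟨ ℚ.*-identityʳ ε ⟩
      ε                ∎
      where open ≤-Reasoning

  small : ∀ A {ε} → 0ℚ < ε → ∃[ δ ] 0ℚ < δ × δ ≤ 1ℚ × A * δ < ε
  small A 0<ε = case archimedean* 0<ε A of λ (n , lt) →
    small-step 0<ε (0≤fromℕ n) (fromℕ-suc n) lt

  0≤^ : ∀ {q} n → 0ℚ ≤ q → 0ℚ ≤ q ^ n
  0≤^ zero    0≤q = ℚ.nonNegative⁻¹ 1ℚ
  0≤^ (suc n) 0≤q = 0≤* 0≤q (0≤^ n 0≤q)

  0<^ : ∀ {q} n → 0ℚ < q → 0ℚ < q ^ n
  0<^ zero    0<q = ℚ.positive⁻¹ 1ℚ
  0<^ (suc n) 0<q = 0<* 0<q (0<^ n 0<q)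

  ^-mono-≤ : ∀ {p q} n → 0ℚ ≤ p → p ≤ q → p ^ n ≤ q ^ n
  ^-mono-≤ zero    0≤p p≤q = ℚ.≤-refl
  ^-mono-≤ (suc n) 0≤p p≤q = *-mono-≤ 0≤p (0≤^ n 0≤p) p≤q (^-mono-≤ n 0≤p p≤q)

  ^-mono-< : ∀ {p q} n .{{_ : ℕ.NonZero n}} → 0ℚ ≤ p → p < q → p ^ n < q ^ n
  ^-mono-< {p} {q} (suc n) 0≤p p<q = ℚ.≤-<-trans
    (*-monoʳ-≤ 0≤p (^-mono-≤ n 0≤p (ℚ.<⇒≤ p<q)))
    (ℚ.*-monoˡ-<-pos (q ^ n) {{positive (0<^ n (ℚ.≤-<-trans 0≤p p<q))}} p<q)

  0^n≡0 : ∀ n .{{_ : ℕ.NonZero n}} → 0ℚ ^ n ≡ 0ℚ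
  0^n≡0 (suc n) = ℚ.*-zeroˡ (0ℚ ^ n)

  p≤p^n : ∀ {p} n .{{_ : ℕ.NonZero n}} → 1ℚ ≤ p → p ≤ p ^ n
  p≤p^n {p} (suc n) 1≤p = subst (_≤ p * p ^ n) (ℚ.*-identityʳ p)
    (*-monoʳ-≤ (ℚ.≤-trans (ℚ.nonNegative⁻¹ 1ℚ) 1≤p) (1≤p^n n))
    where
    1≤p^n : ∀ n → 1ℚ ≤ p ^ n
    1≤p^n zero    = ℚ.≤-refl
    1≤p^n (suc n) = ℚ.≤-trans (1≤p^n n) (subst (_≤ p * p ^ n) (ℚ.*-identityˡ (p ^ n))
      (*-monoˡ-≤ (ℚ.≤-trans (ℚ.nonNegative⁻¹ 1ℚ) (1≤p^n n)) 1≤p))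

  bernoulli-step : ∀ {p h x y k} → 0ℚ ≤ p → 0ℚ ≤ h → 0ℚ ≤ x → 0ℚ ≤ k →
    x * (p + k * h) ≤ p * y → (p * x) * (p + (1ℚ + k) * h) ≤ p * ((p + h) * y)
  bernoulli-step {p} {h} {x} {y} {k} 0≤p 0≤h 0≤x 0≤k le = begin
    p * x * (p + (1ℚ + k) * h)          ≡⟨ ℚ.+-identityʳ (p * x * (p + (1ℚ + k) * h)) ⟨
    p * x * (p + (1ℚ + k) * h) + 0ℚ     ≤⟨ ℚ.+-monoʳ-≤ (p * x * (p + (1ℚ + k) * h)) (0≤* (0≤* 0≤x 0≤h) (0≤* 0≤k 0≤h)) ⟩
    p * x * (p + (1ℚ + k) * h) + (x * h) * (k * h)
      ≡⟨ solve 4 (λ p h x k → p :* x :* (p :+ (con 1ℚ :+ k) :* h) :+ (x :* h) :* (k :* h) := (p :+ h) :* (x :* (p :+ k :* h))) refl p h x k ⟩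
    (p + h) * (x * (p + k * h))         ≤⟨ *-monoʳ-≤ (subst (_≤ p + h) (ℚ.+-identityʳ 0ℚ) (ℚ.+-mono-≤ 0≤p 0≤h)) le ⟩
    (p + h) * (p * y)                   ≡⟨ solve 3 (λ a p y → a :* (p :* y) := p :* (a :* y)) refl (p + h) p y ⟩
    p * ((p + h) * y)                   ∎
    where open ≤-Reasoning

  bernoulli : ∀ {p h} → 0ℚ ≤ p → 0ℚ ≤ h → ∀ m → p ^ m * (p + fromℕ m * h) ≤ p * (p + h) ^ m
  bernoulli {p} {h} 0≤p 0≤h zero = ℚ.≤-reflexive (trans (ℚ.*-identityˡ (p + 0ℚ * h))
    (trans (cong (λ t → p + t) (ℚ.*-zeroˡ h)) (trans (ℚ.+-identityʳ p) (sym (ℚ.*-identityʳ p)))))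
  bernoulli {p} {h} 0≤p 0≤h (suc m) = subst (λ t → p ^ suc m * (p + t * h) ≤ p * (p + h) ^ suc m)
    (sym (fromℕ-suc m))
    (bernoulli-step {p} {h} {p ^ m} {(p + h) ^ m} {fromℕ m} 0≤p 0≤h (0≤^ m 0≤p) (0≤fromℕ m) (bernoulli 0≤p 0≤h m))

  separate-step : ∀ {p q f x y k} → 0ℚ < p → p < q → 0ℚ < x →
    f * p < k * (q - p) → x * (p + (1ℚ + k) * (q - p)) ≤ p * y → f * x < y
  separate-step {p} {q} {f} {x} {y} {k} 0<p p<q 0<x lt le = ℚ.*-cancelˡ-<-nonNeg p {{nonNegative 0≤p}} (begin-strict
    p * (f * x)                  ≡⟨ solve 3 (λ p f x → p :* (f :* x) := x :* (f :* p)) refl p f x ⟩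
    x * (f * p)                  <⟨ ℚ.*-monoʳ-<-pos x {{positive 0<x}} bound ⟩
    x * (p + (1ℚ + k) * h)       ≤⟨ le ⟩
    p * y                        ∎)
    where
    open ≤-Reasoning
    h = q - p
    0≤p = ℚ.<⇒≤ 0<p
    0≤h = ℚ.<⇒≤ (0<q-p p<q)
    bound : f * p < p + (1ℚ + k) * h
    bound = begin-strict
      f * p                     <⟨ lt ⟩
      k * h                     ≡⟨ ℚ.+-identityˡ (k * h) ⟨
      0ℚ + k * h                ≤⟨ ℚ.+-monoˡ-≤ (k * h) (ℚ.+-mono-≤ 0≤p 0≤h) ⟩
      p + h + k * h             ≡⟨ solve 3 (λ p h k → p :+ h :+ k :* h := p :+ (con 1ℚ :+ k) :* h) refl p h k ⟩
      p + (1ℚ + k) * h          ∎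

  separate : ∀ f {p q} → 0ℚ < p → p < q → ∃[ m ] f * p ^ suc m < q ^ suc m
  separate f {p} {q} 0<p p<q = case archimedean* (0<q-p p<q) (f * p) of λ (m , lt) → m , go m lt
    where
    p+[q-p]≡q : p + (q - p) ≡ q
    p+[q-p]≡q = solve 2 (λ p q → p :+ (q :- p) := q) refl p q
    go : ∀ m → f * p < fromℕ m * (q - p) → f * p ^ suc m < q ^ suc m
    go m lt = separate-step {p} {q} {f} {p ^ suc m} {q ^ suc m} {fromℕ m} 0<p p<q (0<^ (suc m) 0<p) lt
      (subst₂ (λ s t → p ^ suc m * (p + s * (q - p)) ≤ p * t ^ suc m) (fromℕ-suc m)
        p+[q-p]≡q (bernoulli (ℚ.<⇒≤ 0<p) (ℚ.<⇒≤ (0<q-p p<q)) (suc m)))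

  q-1<q : ∀ q → q - 1ℚ < q
  q-1<q q = subst (q - 1ℚ <_) (ℚ.+-identityʳ q) (ℚ.+-monoʳ-< q (ℚ.negative⁻¹ (- 1ℚ)))

  q<q+1 : ∀ q → q < q + 1ℚ
  q<q+1 q = q<q+h q (ℚ.positive⁻¹ 1ℚ)

  lower-two : ∀ r s → ∃[ q ] q < r × q < s
  lower-two r s with ℚ.≤-total r s
  ... | inj₁ r≤s = r - 1ℚ , q-1<q r , ℚ.<-≤-trans (q-1<q r) r≤s
  ... | inj₂ s≤r = s - 1ℚ , ℚ.<-≤-trans (q-1<q s) s≤r , q-1<q s

  upper-two : ∀ r s → ∃[ q ] r < q × s < q
  upper-two r s with ℚ.≤-total r s
  ... | inj₁ r≤s = s + 1ℚ , ℚ.≤-<-trans r≤s (q<q+1 s) , q<q+1 s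
  ... | inj₂ s≤r = r + 1ℚ , q<q+1 r , ℚ.≤-<-trans s≤r (q<q+1 r)

open RationalLemmas

------------------------------------------------------------------------
-- Dedekind real numbers

record ℝ : Set₁ where
  field
    Lower Upper     : ℚ → Set
    lower-inhabited : ∃ Lower
    upper-inhabited : ∃ Upper
    lower-closed    : ∀ {p q} → p < q → Lower q → Lower p
    upper-closed    : ∀ {p q} → p < q → Upper p → Upper q
    lower-open      : ∀ {p} → Lower p → ∃[ q ] p < q × Lower q
    upper-open      : ∀ {q} → Upper q → ∃[ p ] p < q × Upper p
    disjoint        : ∀ {q} → ¬ (Lower q × Upper q)
    located         : ∀ {p q} → p < q → Lower p ⊎ Upper q

open ℝ

fromℚ : ℚ → ℝ
fromℚ r = record
  { Lower = _< r
  ; Upper = r <_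
  ; lower-inhabited = r - 1ℚ , q-1<q r
  ; upper-inhabited = r + 1ℚ , q<q+1 r
  ; lower-closed = ℚ.<-trans
  ; upper-closed = λ p<q r<p → ℚ.<-trans r<p p<q
  ; lower-open = λ p<r → ℚ.<-dense p<r
  ; upper-open = λ r<q → case ℚ.<-dense r<q of λ (p , r<p , p<q) → p , p<q , r<p
  ; disjoint = λ (q<r , r<q) → ℚ.<-asym q<r r<q
  ; located = loc
  }
  where
  loc : ∀ {p q} → p < q → p < r ⊎ r < q
  loc {p} p<q with p ℚ.<? r
  ... | yes p<r = inj₁ p<r
  ... | no  p≮r = inj₂ (ℚ.≤-<-trans (ℚ.≮⇒≥ p≮r) p<q)

0ℝ : ℝ
0ℝ = fromℚ 0ℚ

infix 4 _<ℝ_ _≤ℝ_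

_<ℝ_ _≤ℝ_ : ℝ → ℝ → Set
x <ℝ y = ∃[ q ] Upper x q × Lower y q
x ≤ℝ y = ∀ {q} → Lower x q → Lower y q

lower<upper : ∀ x {p q} → Lower x p → Upper x q → p < q
lower<upper x {p} {q} l u with ℚ.<-cmp p q
... | tri< p<q _ _  = p<q
... | tri≈ _ refl _ = contradiction (l , u) (disjoint x)
... | tri> _ _ q<p  = contradiction (lower-closed x q<p l , u) (disjoint x)

module Approximation where

  walk : ∀ x (g : ℕ → ℚ) → (∀ n → g n < g (suc n)) → ∀ n → Lower x (g 0) → Upper x (g n) →
         ∃[ i ] Lower x (g i) × Upper x (g (suc (suc i)))
  walk x g g< zero    l u = contradiction (l , u) (disjoint x)
  walk x g g< (suc n) l u with located x (g< 1)
  ... | inj₂ u₂ = 0 , l , u₂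
  ... | inj₁ l₁ = let i , li , ui = walk x (g ∘ suc) (g< ∘ suc) n l₁ u in suc i , li , ui

  module _ {t : ℚ} (0<t : 0ℚ < t) where
    step : ∀ a n → a + fromℕ (suc n) * t ≡ a + fromℕ n * t + t
    step a n = trans (cong (λ k → a + k * t) (fromℕ-suc n))
      (solve 3 (λ a k t → a :+ (con 1ℚ :+ k) :* t := a :+ k :* t :+ t) refl a (fromℕ n) t)

    narrow-walk : ∀ x {a b} → Lower x a → Upper x b → ∃[ c ] Lower x c × Upper x (c + t + t)
    narrow-walk x {a} {b} la ub = case archimedean* 0<t (b - a) of λ (n , lt) →
      case walk x g g< n (subst (Lower x) start la) (upper-closed x (b<g n lt) ub) of λ (i , li , ui) →
      g i , li , subst (Upper x) (trans (step a (suc i)) (cong (_+ t) (step a i))) ui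
      where
      g : ℕ → ℚ
      g n = a + fromℕ n * t
      g< : ∀ n → g n < g (suc n)
      g< n = subst (g n <_) (sym (step a n)) (q<q+h (g n) 0<t)
      start : a ≡ g 0
      start = sym (trans (cong (λ s → a + s) (ℚ.*-zeroˡ t)) (ℚ.+-identityʳ a))
      b<g : ∀ n → b - a < fromℕ n * t → b < g n
      b<g n lt = subst (_< g n) (solve 2 (λ a b → a :+ (b :- a) := b) refl a b) (ℚ.+-monoʳ-< a lt)

  narrow : ∀ x {h} → 0ℚ < h → ∃[ a ] Lower x a × Upper x (a + h)
  narrow x {h} 0<h = case narrow-walk 0<t x (proj₂ (lower-inhabited x)) (proj₂ (upper-inhabited x)) of
    λ (a , la , ua) → a , la , subst (Upper x) (halves a) ua
    where
    0<t : 0ℚ < ½ * h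
    0<t = 0<* (ℚ.positive⁻¹ ½) 0<h
    halves : ∀ a → a + ½ * h + ½ * h ≡ a + h
    halves a = solve 2 (λ a h → a :+ con ½ :* h :+ con ½ :* h := a :+ h) refl a h

open Approximation

infixl 6 _+ℝ_

_+ℝ_ : ℝ → ℝ → ℝ
x +ℝ y = record
  { Lower = λ q → ∃[ a ] ∃[ c ] Lower x a × Lower y c × q < a + c
  ; Upper = λ q → ∃[ b ] ∃[ d ] Upper x b × Upper y d × b + d < q
  ; lower-inhabited =
      let a , la = lower-inhabited x ; c , lc = lower-inhabited y in
      a + c - 1ℚ , a , c , la , lc , q-1<q (a + c)
  ; upper-inhabited =
      let b , ub = upper-inhabited x ; d , ud = upper-inhabited y in
      b + d + 1ℚ , b , d , ub , ud , q<q+1 (b + d)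
  ; lower-closed = λ p<q (a , c , la , lc , q<) → a , c , la , lc , ℚ.<-trans p<q q<
  ; upper-closed = λ p<q (b , d , ub , ud , <p) → b , d , ub , ud , ℚ.<-trans <p p<q
  ; lower-open = λ (a , c , la , lc , p<) →
      case ℚ.<-dense p< of λ (q , p<q , q<) → q , p<q , a , c , la , lc , q<
  ; upper-open = λ (b , d , ub , ud , <q) →
      case ℚ.<-dense <q of λ (p , <p , p<q) → p , p<q , b , d , ub , ud , <p
  ; disjoint = λ ((a , c , la , lc , q<) , (b , d , ub , ud , <q)) →
      ℚ.<-asym (ℚ.+-mono-< (lower<upper x la ub) (lower<upper y lc ud)) (ℚ.<-trans <q q<)
  ; located = loc
  }
  where
  loc : ∀ {p q} → p < q → (∃[ a ] ∃[ c ] Lower x a × Lower y c × p < a + c)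
                        ⊎ (∃[ b ] ∃[ d ] Upper x b × Upper y d × b + d < q)
  loc {p} {q} p<q = case ℚ.<-dense p<q of λ (t , p<t , t<q) →
    let 0<h = 0<* (ℚ.positive⁻¹ ½) (0<q-p p<t) in
    case narrow x 0<h of λ (a , la , ua) →
    case narrow y 0<h of λ (c , lc , uc) →
    case p ℚ.<? a + c of λ where
      (yes p<) → inj₁ (a , c , la , lc , p<)
      (no  p≮) → inj₂ (a + ½ * (t - p) , c + ½ * (t - p) , ua , uc , far {t} {a} {c} t<q (ℚ.≮⇒≥ p≮))
    where
    far : ∀ {t a c} → t < q → a + c ≤ p → a + ½ * (t - p) + (c + ½ * (t - p)) < q
    far {t} {a} {c} t<q le = begin-strict
      a + ½ * (t - p) + (c + ½ * (t - p))  ≡⟨ solve 4 (λ a c t p → a :+ con ½ :* (t :- p) :+ (c :+ con ½ :* (t :- p)) := a :+ c :+ (t :- p)) refl a c t p ⟩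
      a + c + (t - p)                      ≤⟨ ℚ.+-monoˡ-≤ (t - p) le ⟩
      p + (t - p)                          ≡⟨ solve 2 (λ p t → p :+ (t :- p) := t) refl p t ⟩
      t                                    <⟨ t<q ⟩
      q                                    ∎
      where open ≤-Reasoning

-- The product is the one of interval arithmetic: if a < x < b and c < y < d,
-- then x * y lies strictly between the least and the greatest of the four
-- corners a * c, a * d, b * c and b * d.

AllCorners : (ℚ → Set) → ℚ → ℚ → ℚ → ℚ → Set
AllCorners P a b c d = P (a * c) × P (a * d) × P (b * c) × P (b * d)

module Corners where

  lower-between : ∀ {q a b t} u → a ≤ t → t ≤ b → q < a * u → q < b * u → q < t * u
  lower-between {q} {a} {b} {t} u a≤t t≤b q<au q<bu with ℚ.≤-total 0ℚ u
  ... | inj₁ 0≤u = ℚ.<-≤-trans q<au (*-monoˡ-≤ 0≤u a≤t)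
  ... | inj₂ u≤0 = ℚ.<-≤-trans q<bu (ℚ.*-monoʳ-≤-nonPos u {{nonPositive u≤0}} t≤b)

  upper-between : ∀ {q a b t} u → a ≤ t → t ≤ b → a * u < q → b * u < q → t * u < q
  upper-between {q} {a} {b} {t} u a≤t t≤b au<q bu<q with ℚ.≤-total 0ℚ u
  ... | inj₁ 0≤u = ℚ.≤-<-trans (*-monoˡ-≤ 0≤u t≤b) bu<q
  ... | inj₂ u≤0 = ℚ.≤-<-trans (ℚ.*-monoʳ-≤-nonPos u {{nonPositive u≤0}} a≤t) au<q

  lower-between² : ∀ {q a b c d t u} → a ≤ t → t ≤ b → c ≤ u → u ≤ d →
                   AllCorners (q <_) a b c d → q < t * u
  lower-between² {q} {a} {b} {c} {d} {t} {u} a≤t t≤b c≤u u≤d (ac , ad , bc , bd) =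
    lower-between u a≤t t≤b (side a ac ad) (side b bc bd)
    where
    side : ∀ e → q < e * c → q < e * d → q < e * u
    side e ec ed = subst (q <_) (ℚ.*-comm u e) (lower-between e c≤u u≤d
      (subst (q <_) (ℚ.*-comm e c) ec) (subst (q <_) (ℚ.*-comm e d) ed))

  upper-between² : ∀ {q a b c d t u} → a ≤ t → t ≤ b → c ≤ u → u ≤ d →
                   AllCorners (_< q) a b c d → t * u < q
  upper-between² {q} {a} {b} {c} {d} {t} {u} a≤t t≤b c≤u u≤d (ac , ad , bc , bd) =
    upper-between u a≤t t≤b (side a ac ad) (side b bc bd)
    where
    side : ∀ e → e * c < q → e * d < q → e * u < q
    side e ec ed = subst (_< q) (ℚ.*-comm u e) (upper-between e c≤u u≤d
      (subst (_< q) (ℚ.*-comm e c) ec) (subst (_< q) (ℚ.*-comm e d) ed))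

  meet : ∀ x {a a′ b b′} → Lower x a → Lower x a′ → Upper x b → Upper x b′ →
         ∃[ t ] a ≤ t × a′ ≤ t × t ≤ b × t ≤ b′
  meet x {a} {a′} la la′ ub ub′ with ℚ.≤-total a a′
  ... | inj₁ a≤a′ = a′ , a≤a′ , ℚ.≤-refl , ℚ.<⇒≤ (lower<upper x la′ ub) , ℚ.<⇒≤ (lower<upper x la′ ub′)
  ... | inj₂ a′≤a = a , ℚ.≤-refl , a′≤a , ℚ.<⇒≤ (lower<upper x la ub) , ℚ.<⇒≤ (lower<upper x la ub′)

  below-two : ∀ {p r s} → p < r → p < s → ∃[ q ] p < q × q < r × q < s
  below-two {p} {r} {s} p<r p<s with ℚ.≤-total r s
  ... | inj₁ r≤s = case ℚ.<-dense p<r of λ (q , p<q , q<r) → q , p<q , q<r , ℚ.<-≤-trans q<r r≤s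
  ... | inj₂ s≤r = case ℚ.<-dense p<s of λ (q , p<q , q<s) → q , p<q , ℚ.<-≤-trans q<s s≤r , q<s

  above-two : ∀ {q r s} → r < q → s < q → ∃[ p ] p < q × r < p × s < p
  above-two {q} {r} {s} r<q s<q with ℚ.≤-total r s
  ... | inj₁ r≤s = case ℚ.<-dense s<q of λ (p , s<p , p<q) → p , p<q , ℚ.≤-<-trans r≤s s<p , s<p
  ... | inj₂ s≤r = case ℚ.<-dense r<q of λ (p , r<p , p<q) → p , p<q , r<p , ℚ.≤-<-trans s≤r r<p

  lower-corners-open : ∀ {p a b c d} → AllCorners (p <_) a b c d → ∃[ q ] p < q × AllCorners (q <_) a b c d
  lower-corners-open (ac , ad , bc , bd) =
    case below-two ac ad of λ (q₁ , p<q₁ , <ac , <ad) →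
    case below-two bc bd of λ (q₂ , p<q₂ , <bc , <bd) →
    case below-two p<q₁ p<q₂ of λ (q , p<q , q<q₁ , q<q₂) →
    q , p<q , ℚ.<-trans q<q₁ <ac , ℚ.<-trans q<q₁ <ad , ℚ.<-trans q<q₂ <bc , ℚ.<-trans q<q₂ <bd

  upper-corners-open : ∀ {q a b c d} → AllCorners (_< q) a b c d → ∃[ p ] p < q × AllCorners (_< p) a b c d
  upper-corners-open (ac , ad , bc , bd) =
    case above-two ac ad of λ (p₁ , p₁<q , ac< , ad<) →
    case above-two bc bd of λ (p₂ , p₂<q , bc< , bd<) →
    case above-two p₁<q p₂<q of λ (p , p<q , p₁<p , p₂<p) →
    p , p<q , ℚ.<-trans ac< p₁<p , ℚ.<-trans ad< p₁<p , ℚ.<-trans bc< p₂<p , ℚ.<-trans bd< p₂<p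

  bound : ∀ x → ∃[ M ] 0ℚ ≤ M × Lower x (- M) × Upper x M
  bound x = case archimedean (- a) of λ (m , -a<m) → case archimedean b of λ (n , b<n) →
    fromℕ m + fromℕ n , ℚ.+-mono-≤ (0≤fromℕ m) (0≤fromℕ n)
    , lower-closed x (-M<a (0≤fromℕ n) -a<m) (proj₂ (lower-inhabited x))
    , upper-closed x (b<M (0≤fromℕ m) b<n) (proj₂ (upper-inhabited x))
    where
    a b : ℚ
    a = proj₁ (lower-inhabited x)
    b = proj₁ (upper-inhabited x)
    -M<a : ∀ {r s} → 0ℚ ≤ s → - a < r → - (r + s) < a
    -M<a {r} {s} 0≤s -a<r = subst (- (r + s) <_) (solve 1 (λ a → :- (:- a) := a) refl a)
      (ℚ.neg-antimono-< (subst (_< r + s) (ℚ.+-identityʳ (- a)) (ℚ.+-mono-<-≤ -a<r 0≤s)))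
    b<M : ∀ {r s} → 0ℚ ≤ r → b < s → b < r + s
    b<M {r} {s} 0≤r b<s = subst (_< r + s) (ℚ.+-identityˡ b) (ℚ.+-mono-≤-< 0≤r b<s)

  Within : ℚ → ℚ → Set
  Within M t = - M ≤ t × t ≤ M

  within : ∀ x {N M a δ} → Lower x (- N) → Upper x N → Lower x a → Upper x (a + δ) →
           0ℚ < δ → δ ≤ 1ℚ → N + 1ℚ ≤ M → Within M a × Within M (a + δ)
  within x {N} {M} {a} {δ} l u la ub 0<δ δ≤1 N+1≤M =
    (-M≤a , ℚ.≤-trans a≤a+δ a+δ≤M) , (ℚ.≤-trans -M≤a a≤a+δ , a+δ≤M)
    where
    open ≤-Reasoning
    a≤a+δ : a ≤ a + δ
    a≤a+δ = ℚ.<⇒≤ (q<q+h a 0<δ)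
    a+δ≤M : a + δ ≤ M
    a+δ≤M = begin
      a + δ    ≤⟨ ℚ.+-mono-≤ (ℚ.<⇒≤ (lower<upper x la u)) δ≤1 ⟩
      N + 1ℚ   ≤⟨ N+1≤M ⟩
      M        ∎
    -M≤a : - M ≤ a
    -M≤a = begin
      - M            ≤⟨ ℚ.neg-antimono-≤ N+1≤M ⟩
      - (N + 1ℚ)     ≡⟨ ℚ.neg-distrib-+ N 1ℚ ⟩
      - N + - 1ℚ     ≤⟨ ℚ.+-mono-≤ (ℚ.<⇒≤ (lower<upper x l ub)) (ℚ.neg-antimono-≤ δ≤1) ⟩
      a + δ + - δ    ≡⟨ solve 2 (λ a δ → a :+ δ :+ :- δ := a) refl a δ ⟩
      a              ∎

  scale-bounds : ∀ {M t δ} → 0ℚ ≤ δ → - M ≤ t → t ≤ M → - (M * δ) ≤ t * δ × t * δ ≤ M * δ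
  scale-bounds {M} {t} {δ} 0≤δ -M≤t t≤M =
    subst (_≤ t * δ) (sym (ℚ.neg-distribˡ-* M δ)) (*-monoˡ-≤ 0≤δ -M≤t) , *-monoˡ-≤ 0≤δ t≤M

  corners-split : ∀ {M δ a c p q} → 0ℚ ≤ M → 0ℚ < δ →
                  Within M a → Within M c → Within M (c + δ) →
                  p + (+ 4 / 1) * (M * δ) < q →
                  AllCorners (p <_) a (a + δ) c (c + δ) ⊎ AllCorners (_< q) a (a + δ) c (c + δ)
  corners-split {M} {δ} {a} {c} {p} {q} 0≤M 0<δ (-M≤a , a≤M) (-M≤c , c≤M) (-M≤d , d≤M) p+4η<q = result
    where
    open ≤-Reasoning
    0≤δ = ℚ.<⇒≤ 0<δ
    η = M * δ
    -- the displacements of the other corners from a * c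
    f g k : ℚ
    f = a * δ
    g = c * δ
    k = (c + δ) * δ
    fb = scale-bounds {M} {a} 0≤δ -M≤a a≤M
    gb = scale-bounds {M} {c} 0≤δ -M≤c c≤M
    kb = scale-bounds {M} {c + δ} 0≤δ -M≤d d≤M
    0≤η : 0ℚ ≤ η
    0≤η = 0≤* 0≤M 0≤δ
    ad≡ : a * (c + δ) ≡ a * c + (0ℚ + f)
    ad≡ = solve 3 (λ a c δ → a :* (c :+ δ) := a :* c :+ (con 0ℚ :+ a :* δ)) refl a c δ
    bc≡ : (a + δ) * c ≡ a * c + (0ℚ + g)
    bc≡ = solve 3 (λ a c δ → (a :+ δ) :* c := a :* c :+ (con 0ℚ :+ c :* δ)) refl a c δ
    bd≡ : (a + δ) * (c + δ) ≡ a * c + (f + k)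
    bd≡ = solve 3 (λ a c δ → (a :+ δ) :* (c :+ δ) := a :* c :+ (a :* δ :+ (c :+ δ) :* δ)) refl a c δ
    ac≡ : a * c ≡ a * c + (0ℚ + 0ℚ)
    ac≡ = sym (ℚ.+-identityʳ (a * c))
    Small : ℚ → Set
    Small s = - η ≤ s × s ≤ η
    0-small : Small 0ℚ
    0-small = ℚ.neg-antimono-≤ 0≤η , 0≤η
    lower-corner : ∀ {z s t} → p + (η + η) < a * c → Small s → Small t → z ≡ a * c + (s + t) → p < z
    lower-corner {z} {s} {t} lt (-η≤s , _) (-η≤t , _) z≡ = begin-strict
      p                            ≡⟨ solve 2 (λ p η → p := p :+ (η :+ η) :+ (:- η :+ :- η)) refl p η ⟩
      p + (η + η) + (- η + - η)    <⟨ ℚ.+-monoˡ-< (- η + - η) lt ⟩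
      a * c + (- η + - η)          ≤⟨ ℚ.+-monoʳ-≤ (a * c) (ℚ.+-mono-≤ -η≤s -η≤t) ⟩
      a * c + (s + t)              ≡⟨ z≡ ⟨
      z                            ∎
    upper-corner : ∀ {z s t} → a * c ≤ p + (η + η) → Small s → Small t → z ≡ a * c + (s + t) → z < q
    upper-corner {z} {s} {t} le (_ , s≤η) (_ , t≤η) z≡ = begin-strict
      z                            ≡⟨ z≡ ⟩
      a * c + (s + t)              ≤⟨ ℚ.+-mono-≤ le (ℚ.+-mono-≤ s≤η t≤η) ⟩
      p + (η + η) + (η + η)        ≡⟨ solve 2 (λ p η → p :+ (η :+ η) :+ (η :+ η) := p :+ con (+ 4 / 1) :* η) refl p η ⟩
      p + (+ 4 / 1) * η            <⟨ p+4η<q ⟩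
      q                            ∎
    result : AllCorners (p <_) a (a + δ) c (c + δ) ⊎ AllCorners (_< q) a (a + δ) c (c + δ)
    result with p + (η + η) ℚ.<? a * c
    ... | yes lt = inj₁ (lower-corner lt 0-small 0-small ac≡ , lower-corner lt 0-small fb ad≡
                        , lower-corner lt 0-small gb bc≡ , lower-corner lt fb kb bd≡)
    ... | no  ≮ = let le = ℚ.≮⇒≥ ≮ in
                  inj₂ (upper-corner le 0-small 0-small ac≡ , upper-corner le 0-small fb ad≡
                        , upper-corner le 0-small gb bc≡ , upper-corner le fb kb bd≡)

open Corners

infixl 7 _*ℝ_

_*ℝ_ : ℝ → ℝ → ℝ
x *ℝ y = record
  { Lower = λ q → ∃[ a ] ∃[ b ] ∃[ c ] ∃[ d ]
      Lower x a × Upper x b × Lower y c × Upper y d × AllCorners (q <_) a b c d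
  ; Upper = λ q → ∃[ a ] ∃[ b ] ∃[ c ] ∃[ d ]
      Lower x a × Upper x b × Lower y c × Upper y d × AllCorners (_< q) a b c d
  ; lower-inhabited = case lower-corner a b c d of λ (q , qs) → q , a , b , c , d , la , ub , lc , ud , qs
  ; upper-inhabited = case upper-corner a b c d of λ (q , qs) → q , a , b , c , d , la , ub , lc , ud , qs
  ; lower-closed = λ p<q (a , b , c , d , la , ub , lc , ud , ac , ad , bc , bd) →
      a , b , c , d , la , ub , lc , ud
      , ℚ.<-trans p<q ac , ℚ.<-trans p<q ad , ℚ.<-trans p<q bc , ℚ.<-trans p<q bd
  ; upper-closed = λ p<q (a , b , c , d , la , ub , lc , ud , ac , ad , bc , bd) →
      a , b , c , d , la , ub , lc , ud
      , ℚ.<-trans ac p<q , ℚ.<-trans ad p<q , ℚ.<-trans bc p<q , ℚ.<-trans bd p<q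
  ; lower-open = λ (a , b , c , d , la , ub , lc , ud , ps) →
      case lower-corners-open {a = a} {b} {c} {d} ps of λ (q , p<q , qs) →
      q , p<q , a , b , c , d , la , ub , lc , ud , qs
  ; upper-open = λ (a , b , c , d , la , ub , lc , ud , qs) →
      case upper-corners-open {a = a} {b} {c} {d} qs of λ (p , p<q , ps) →
      p , p<q , a , b , c , d , la , ub , lc , ud , ps
  ; disjoint = λ ((a , b , c , d , la , ub , lc , ud , ls) , (a′ , b′ , c′ , d′ , la′ , ub′ , lc′ , ud′ , us)) →
      case meet x la la′ ub ub′ of λ (t , a≤t , a′≤t , t≤b , t≤b′) →
      case meet y lc lc′ ud ud′ of λ (u , c≤u , c′≤u , u≤d , u≤d′) →
      ℚ.<-asym (lower-between² a≤t t≤b c≤u u≤d ls) (upper-between² a′≤t t≤b′ c′≤u u≤d′ us)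
  ; located = loc
  }
  where
  a b c d : ℚ
  a = proj₁ (lower-inhabited x)
  b = proj₁ (upper-inhabited x)
  c = proj₁ (lower-inhabited y)
  d = proj₁ (upper-inhabited y)
  la = proj₂ (lower-inhabited x)
  ub = proj₂ (upper-inhabited x)
  lc = proj₂ (lower-inhabited y)
  ud = proj₂ (upper-inhabited y)
  lower-corner : ∀ a b c d → ∃[ q ] AllCorners (q <_) a b c d
  lower-corner a b c d =
    case lower-two (a * c) (a * d) of λ (p , p₁ , p₂) →
    case lower-two (b * c) (b * d) of λ (r , r₁ , r₂) →
    case lower-two p r of λ (q , q<p , q<r) →
    q , ℚ.<-trans q<p p₁ , ℚ.<-trans q<p p₂ , ℚ.<-trans q<r r₁ , ℚ.<-trans q<r r₂
  upper-corner : ∀ a b c d → ∃[ q ] AllCorners (_< q) a b c d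
  upper-corner a b c d =
    case upper-two (a * c) (a * d) of λ (p , p₁ , p₂) →
    case upper-two (b * c) (b * d) of λ (r , r₁ , r₂) →
    case upper-two p r of λ (q , p<q , r<q) →
    q , ℚ.<-trans p₁ p<q , ℚ.<-trans p₂ p<q , ℚ.<-trans r₁ r<q , ℚ.<-trans r₂ r<q
  Bracket : (ℚ → ℚ → ℚ → ℚ → Set) → Set
  Bracket P = ∃[ a ] ∃[ b ] ∃[ c ] ∃[ d ] Lower x a × Upper x b × Lower y c × Upper y d × P a b c d
  loc : ∀ {p q} → p < q → Bracket (AllCorners (p <_)) ⊎ Bracket (AllCorners (_< q))
  loc {p} {q} p<q =
    case bound x of λ (M , 0≤M , lM , uM) →
    case bound y of λ (N , 0≤N , lN , uN) →
    case small ((+ 4 / 1) * (M + N + 1ℚ)) (0<q-p p<q) of λ (δ , 0<δ , δ≤1 , 4Kδ<q-p) →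
    case narrow x 0<δ of λ (a , la , ub) →
    case narrow y 0<δ of λ (c , lc , ud) →
    case within x lM uM la ub 0<δ δ≤1 (M+1≤K {M} {N} 0≤N) of λ (wa , wb) →
    case within y lN uN lc ud 0<δ δ≤1 (N+1≤K {M} {N} 0≤M) of λ (wc , wd) →
    case corners-split {M + N + 1ℚ} {δ} {a} {c} {p} {q} (0≤K {M} {N} 0≤M 0≤N) 0<δ wa wc wd (enough {M + N + 1ℚ} {δ} 4Kδ<q-p) of λ where
      (inj₁ ls) → inj₁ (a , a + δ , c , c + δ , la , ub , lc , ud , ls)
      (inj₂ us) → inj₂ (a , a + δ , c , c + δ , la , ub , lc , ud , us)
    where
    M+1≤K : ∀ {M N} → 0ℚ ≤ N → M + 1ℚ ≤ M + N + 1ℚ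
    M+1≤K {M} {N} 0≤N = ℚ.+-monoˡ-≤ 1ℚ (subst (_≤ M + N) (ℚ.+-identityʳ M) (ℚ.+-monoʳ-≤ M 0≤N))
    N+1≤K : ∀ {M N} → 0ℚ ≤ M → N + 1ℚ ≤ M + N + 1ℚ
    N+1≤K {M} {N} 0≤M = ℚ.+-monoˡ-≤ 1ℚ (subst (_≤ M + N) (ℚ.+-identityˡ N) (ℚ.+-monoˡ-≤ N 0≤M))
    0≤K : ∀ {M N} → 0ℚ ≤ M → 0ℚ ≤ N → 0ℚ ≤ M + N + 1ℚ
    0≤K 0≤M 0≤N = ℚ.+-mono-≤ (ℚ.+-mono-≤ 0≤M 0≤N) (ℚ.nonNegative⁻¹ 1ℚ)
    enough : ∀ {K δ} → (+ 4 / 1) * K * δ < q - p → p + (+ 4 / 1) * (K * δ) < q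
    enough {K} {δ} lt = begin-strict
      p + (+ 4 / 1) * (K * δ)  ≡⟨ cong (λ s → p + s) (ℚ.*-assoc (+ 4 / 1) K δ) ⟨
      p + (+ 4 / 1) * K * δ    <⟨ ℚ.+-monoʳ-< p lt ⟩
      p + (q - p)              ≡⟨ solve 2 (λ p q → p :+ (q :- p) := q) refl p q ⟩
      q                        ∎
      where open ≤-Reasoning

------------------------------------------------------------------------
-- Roots and powers

-- root n m is the nonnegative n-th root of m: the rationals r ≥ 0 with r ^ n ≤ m
-- bound it from below, those with r ^ n ≥ m bound it from above.

root : ∀ n .{{_ : ℕ.NonZero n}} → ℕ → ℝ
root n m = record
  { Lower = λ q → ∃[ r ] q < r × 0ℚ ≤ r × r ^ n ≤ fromℕ m
  ; Upper = λ q → ∃[ r ] r < q × 0ℚ ≤ r × fromℕ m ≤ r ^ n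
  ; lower-inhabited = 0ℚ - 1ℚ , 0ℚ , q-1<q 0ℚ , ℚ.≤-refl , 0^n≤m
  ; upper-inhabited = 1ℚ + fromℕ m + 1ℚ , 1ℚ + fromℕ m , q<q+1 (1ℚ + fromℕ m) , 0≤1+m , m≤
  ; lower-closed = λ p<q (r , q<r , r-ok) → r , ℚ.<-trans p<q q<r , r-ok
  ; upper-closed = λ p<q (r , r<p , r-ok) → r , ℚ.<-trans r<p p<q , r-ok
  ; lower-open = λ (r , p<r , r-ok) → case ℚ.<-dense p<r of λ (q , p<q , q<r) → q , p<q , r , q<r , r-ok
  ; upper-open = λ (r , r<q , r-ok) → case ℚ.<-dense r<q of λ (p , r<p , p<q) → p , p<q , r , r<p , r-ok
  ; disjoint = λ ((r , q<r , 0≤r , r^n≤m) , (s , s<q , 0≤s , m≤s^n)) →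
      ℚ.<-irrefl refl (ℚ.<-≤-trans (^-mono-< n 0≤s (ℚ.<-trans s<q q<r)) (ℚ.≤-trans r^n≤m m≤s^n))
  ; located = loc
  }
  where
  0^n≤m : 0ℚ ^ n ≤ fromℕ m
  0^n≤m = subst (_≤ fromℕ m) (sym (0^n≡0 n)) (0≤fromℕ m)
  0≤1 : 0ℚ ≤ 1ℚ
  0≤1 = ℚ.nonNegative⁻¹ 1ℚ
  1≤1+m : 1ℚ ≤ 1ℚ + fromℕ m
  1≤1+m = subst (_≤ 1ℚ + fromℕ m) (ℚ.+-identityʳ 1ℚ) (ℚ.+-monoʳ-≤ 1ℚ (0≤fromℕ m))
  0≤1+m : 0ℚ ≤ 1ℚ + fromℕ m
  0≤1+m = ℚ.≤-trans 0≤1 1≤1+m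
  m≤ : fromℕ m ≤ (1ℚ + fromℕ m) ^ n
  m≤ = ℚ.≤-trans (subst (_≤ 1ℚ + fromℕ m) (ℚ.+-identityˡ (fromℕ m)) (ℚ.+-monoˡ-≤ (fromℕ m) 0≤1))
    (p≤p^n n 1≤1+m)
  loc : ∀ {p q} → p < q → (∃[ r ] p < r × 0ℚ ≤ r × r ^ n ≤ fromℕ m)
                        ⊎ (∃[ r ] r < q × 0ℚ ≤ r × fromℕ m ≤ r ^ n)
  loc {p} {q} p<q = case ℚ.<-dense p<q of λ (t , p<t , t<q) →
    case ℚ.≤-total t 0ℚ of λ where
      (inj₁ t≤0) → inj₁ (0ℚ , ℚ.<-≤-trans p<t t≤0 , ℚ.≤-refl , 0^n≤m)
      (inj₂ 0≤t) → case ℚ.≤-total (t ^ n) (fromℕ m) of λ where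
        (inj₁ t^n≤m) → inj₁ (t , p<t , 0≤t , t^n≤m)
        (inj₂ m≤t^n) → inj₂ (t , t<q , 0≤t , m≤t^n)

2ℚ : ℚ
2ℚ = + 2 / 1

2^ᶻ_ : ℤ → ℚ
2^ᶻ (+ n)    = 2ℚ ^ n
2^ᶻ -[1+ n ] = ½ ^ suc n

module IntegerPowers where

  0<2^ᶻ : ∀ i → 0ℚ < 2^ᶻ i
  0<2^ᶻ (+ n)    = 0<^ n (ℚ.positive⁻¹ 2ℚ)
  0<2^ᶻ -[1+ n ] = 0<^ (suc n) (ℚ.positive⁻¹ ½)

  2^ᶻ-suc : ∀ i → 2^ᶻ (ℤ.suc i) ≡ 2ℚ * 2^ᶻ i
  2^ᶻ-suc (+ n)        = refl
  2^ᶻ-suc -[1+ zero ]  = refl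
  2^ᶻ-suc -[1+ suc n ] = sym (trans (sym (ℚ.*-assoc 2ℚ ½ (½ ^ suc n))) (ℚ.*-identityˡ (½ ^ suc n)))

  2^ᶻ-mono-+ : ∀ i k → 2^ᶻ i < 2^ᶻ (+ suc k ℤ.+ i)
  2^ᶻ-mono-+ i zero = subst₂ _<_ (ℚ.*-identityˡ (2^ᶻ i)) (sym (2^ᶻ-suc i))
    (ℚ.*-monoˡ-<-pos (2^ᶻ i) {{positive (0<2^ᶻ i)}} {1ℚ} {2ℚ} (*<* (ℤ.+<+ (ℕ.s≤s (ℕ.s≤s ℕ.z≤n)))))
  2^ᶻ-mono-+ i (suc k) = ℚ.<-trans (2^ᶻ-mono-+ i k)
    (subst (λ j → 2^ᶻ (+ suc k ℤ.+ i) < 2^ᶻ j) (sym (ℤ.+-assoc (+ 1) (+ suc k) i)) (2^ᶻ-mono-+ (+ suc k ℤ.+ i) zero))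

  2^ᶻ-mono-< : ∀ {i j} → i ℤ.< j → 2^ᶻ i < 2^ᶻ j
  2^ᶻ-mono-< {i} {j} i<j = go (j ℤ.- i) (subst (ℤ._< j ℤ.- i) (ℤ.+-inverseʳ i) (ℤ.+-monoˡ-< (ℤ.- i) i<j)) eq
    where
    eq : (j ℤ.- i) ℤ.+ i ≡ j
    eq = trans (ℤ.+-assoc j (ℤ.- i) i) (trans (cong (λ k → j ℤ.+ k) (ℤ.+-inverseˡ i)) (ℤ.+-identityʳ j))
    go : ∀ d → ℤ.0ℤ ℤ.< d → d ℤ.+ i ≡ j → 2^ᶻ i < 2^ᶻ j
    go (+ suc k) _ refl = 2^ᶻ-mono-+ i k
    go (+ zero) (ℤ.+<+ ()) _

  2^ᶻ-neg : ∀ k → 2^ᶻ (ℤ.- + k) ≡ ½ ^ k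
  2^ᶻ-neg zero    = refl
  2^ᶻ-neg (suc k) = refl

  2^ᶻ-* : ∀ i n → 2^ᶻ (i ℤ.* + n) ≡ (2^ᶻ i) ^ n
  2^ᶻ-* (+ m) n = trans (cong 2^ᶻ_ (sym (ℤ.pos-* m n))) (sym (^-assocʳ 2ℚ m n))
  2^ᶻ-* -[1+ m ] n = trans (cong 2^ᶻ_ eq) (trans (2^ᶻ-neg (suc m ℕ.* n)) (sym (^-assocʳ ½ (suc m) n)))
    where
    eq : -[1+ m ] ℤ.* + n ≡ ℤ.- + (suc m ℕ.* n)
    eq = trans (sym (ℤ.neg-distribˡ-* (+ suc m) (+ n))) (cong ℤ.-_ (sym (ℤ.pos-* (suc m) n)))

  grid-below : ∀ i d m → -[1+ ℤ.∣ i ∣ ℕ.* suc m ] ℤ.* + suc d ℤ.< i ℤ.* + suc m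
  grid-below (+ n)    d m = subst (-[1+ n ℕ.* suc m ] ℤ.* + suc d ℤ.<_) (ℤ.pos-* n (suc m)) ℤ.-<+
  grid-below -[1+ n ] d m = ℤ.-<- (ℕ.≤-trans (ℕ.m≤m*n (suc n ℕ.* suc m) (suc d))
    (ℕ.m≤n+m ((suc n ℕ.* suc m) ℕ.* suc d) d))

  grid-above : ∀ i d m → i ℤ.* + suc m ℤ.< + suc (ℤ.∣ i ∣ ℕ.* suc m) ℤ.* + suc d
  grid-above (+ n)    d m = subst (ℤ._< + suc (n ℕ.* suc m) ℤ.* + suc d) (ℤ.pos-* n (suc m))
    (ℤ.+<+ (ℕ.m≤m*n (suc (n ℕ.* suc m)) (suc d)))
  grid-above -[1+ n ] d m = ℤ.-<+

  grid : ∀ x m → ∃[ j ] Lower x (j / suc m) × Upper x ((+ 2 ℤ.+ j) / suc m)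
  grid x m = case walk x g g< N (lower-closed x below la) (subst (λ k → Upper x (k / suc m)) (sym top) (upper-closed x above ub)) of
    λ (n , ln , un) → + n ℤ.+ j₀ , ln , subst (λ k → Upper x (k / suc m)) (ℤ.+-assoc (+ 2) (+ n) j₀) un
    where
    a b : ℚ
    a = proj₁ (lower-inhabited x)
    b = proj₁ (upper-inhabited x)
    la = proj₂ (lower-inhabited x)
    ub = proj₂ (upper-inhabited x)
    K L N : ℕ
    K = ℤ.∣ ↥ a ∣ ℕ.* suc m
    L = ℤ.∣ ↥ b ∣ ℕ.* suc m
    N = suc L ℕ.+ suc K
    j₀ : ℤ
    j₀ = -[1+ K ]
    g : ℕ → ℚ
    g n = (+ n ℤ.+ j₀) / suc m
    g< : ∀ n → g n < g (suc n)
    g< n = /-mono-< (+ n ℤ.+ j₀) (suc m) (+ suc n ℤ.+ j₀) (suc m)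
      (ℤ.*-monoʳ-<-pos (+ suc m) (ℤ.+-monoˡ-< j₀ (ℤ.+<+ (ℕ.n<1+n n))))
    top : + N ℤ.+ j₀ ≡ + suc L
    top = trans (ℤ.+-assoc (+ suc L) (+ suc K) j₀)
      (trans (cong (λ k → + suc L ℤ.+ k) (ℤ.+-inverseʳ (+ suc K))) (ℤ.+-identityʳ (+ suc L)))
    below : j₀ / suc m < a
    below = subst (j₀ / suc m <_) (ℚ.↥p/↧p≡p a) (/-mono-< j₀ (suc m) (↥ a) (↧ₙ a) (grid-below (↥ a) _ m))
    above : b < + suc L / suc m
    above = subst (_< + suc L / suc m) (ℚ.↥p/↧p≡p b) (/-mono-< (↥ b) (↧ₙ b) (+ suc L) (suc m) (grid-above (↥ b) _ m))

open IntegerPowers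

-- r ≤ 2 ^ (a / b), respectively r ≥ 2 ^ (a / b), for r ≥ 0 and b ≥ 1.

BelowPower AbovePower : ℤ → ℕ → ℚ → Set
BelowPower a b r = 0ℚ ≤ r × r ^ b ≤ 2^ᶻ a
AbovePower a b r = 0ℚ ≤ r × 2^ᶻ a ≤ r ^ b

power-order : ∀ {a b a′ b′ r s} .{{_ : ℕ.NonZero b}} .{{_ : ℕ.NonZero b′}} → a / b < a′ / b′ →
              BelowPower a b r → AbovePower a′ b′ s → r ≤ s
power-order {a} {b} {a′} {b′} {r} {s} lt (0≤r , r≤) (0≤s , ≤s) = ℚ.≮⇒≥ λ s<r → ℚ.<-irrefl refl (begin-strict
  (r ^ b) ^ b′             ≤⟨ ^-mono-≤ b′ (0≤^ b 0≤r) r≤ ⟩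
  (2^ᶻ a) ^ b′             ≡⟨ 2^ᶻ-* a b′ ⟨
  2^ᶻ (a ℤ.* + b′)         <⟨ 2^ᶻ-mono-< (/-cancel-< a b a′ b′ lt) ⟩
  2^ᶻ (a′ ℤ.* + b)         ≡⟨ 2^ᶻ-* a′ b ⟩
  (2^ᶻ a′) ^ b             ≤⟨ ^-mono-≤ b (ℚ.<⇒≤ (0<2^ᶻ a′)) ≤s ⟩
  (s ^ b′) ^ b             ≡⟨ ^-assocʳ s b′ b ⟩
  s ^ (b′ ℕ.* b)           ≡⟨ cong (s ^_) (ℕ.*-comm b′ b) ⟩
  s ^ (b ℕ.* b′)           ≤⟨ ^-mono-≤ (b ℕ.* b′) 0≤s (ℚ.<⇒≤ s<r) ⟩
  r ^ (b ℕ.* b′)           ≡⟨ ^-assocʳ r b b′ ⟨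
  (r ^ b) ^ b′             ∎)
  where open ≤-Reasoning

-- The real power 2 ^ x is determined by the rational powers 2 ^ (a / b) with
-- a / b < x, which lie below it, and those with x < a / b, which lie above it.

infix 8 2^_

2^_ : ℝ → ℝ
2^ x = record
  { Lower = Lo
  ; Upper = Up
  ; lower-inhabited = 0ℚ - 1ℚ , lower-neg (q-1<q 0ℚ)
  ; upper-inhabited = up
  ; lower-closed = λ p<q (a , b , l , r , q<r , r-ok) → a , b , l , r , ℚ.<-trans p<q q<r , r-ok
  ; upper-closed = λ p<q (a , b , u , r , r<p , r-ok) → a , b , u , r , ℚ.<-trans r<p p<q , r-ok
  ; lower-open = λ (a , b , l , r , p<r , r-ok) →
      case ℚ.<-dense p<r of λ (q , p<q , q<r) → q , p<q , a , b , l , r , q<r , r-ok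
  ; upper-open = λ (a , b , u , r , r<q , r-ok) →
      case ℚ.<-dense r<q of λ (p , r<p , p<q) → p , p<q , a , b , u , r , r<p , r-ok
  ; disjoint = λ ((a , b , l , r , q<r , r-ok) , (a′ , b′ , u , s , s<q , s-ok)) →
      ℚ.<-irrefl refl (ℚ.<-≤-trans (ℚ.<-trans s<q q<r)
        (power-order {a} {suc b} {a′} {suc b′} (lower<upper x l u) r-ok s-ok))
  ; located = loc
  }
  where
  Lo Up : ℚ → Set
  Lo q = ∃[ a ] ∃[ b ] Lower x (a / suc b) × ∃[ r ] q < r × BelowPower a (suc b) r
  Up q = ∃[ a ] ∃[ b ] Upper x (a / suc b) × ∃[ r ] r < q × AbovePower a (suc b) r
  lower-neg : ∀ {q} → q < 0ℚ → Lo q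
  lower-neg q<0 = case grid x 0 of λ (j , lj , uj) → j , 0 , lj , 0ℚ , q<0 , ℚ.≤-refl , ℚ.<⇒≤ (0<2^ᶻ j)
  up : ∃ Up
  up = case grid x 0 of λ (j , lj , uj) →
    2^ᶻ (+ 2 ℤ.+ j) + 1ℚ , + 2 ℤ.+ j , 0 , uj , 2^ᶻ (+ 2 ℤ.+ j) , q<q+1 (2^ᶻ (+ 2 ℤ.+ j))
    , ℚ.<⇒≤ (0<2^ᶻ (+ 2 ℤ.+ j)) , ℚ.≤-reflexive (sym (ℚ.*-identityʳ (2^ᶻ (+ 2 ℤ.+ j))))
  four : ∀ j → 2^ᶻ (+ 2 ℤ.+ j) ≡ 2ℚ * 2ℚ * 2^ᶻ j
  four j = trans (cong 2^ᶻ_ (ℤ.+-assoc (+ 1) (+ 1) j)) (trans (2^ᶻ-suc (+ 1 ℤ.+ j))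
    (trans (cong (2ℚ *_) (2^ᶻ-suc j)) (sym (ℚ.*-assoc 2ℚ 2ℚ (2^ᶻ j)))))
  above : ∀ j {y z} → 2^ᶻ j ≤ y → 2ℚ * 2ℚ * y < z → 2^ᶻ (+ 2 ℤ.+ j) ≤ z
  above j {y} {z} le lt = begin
    2^ᶻ (+ 2 ℤ.+ j)      ≡⟨ four j ⟩
    2ℚ * 2ℚ * 2^ᶻ j      ≤⟨ *-monoʳ-≤ (ℚ.nonNegative⁻¹ (2ℚ * 2ℚ)) le ⟩
    2ℚ * 2ℚ * y          <⟨ lt ⟩
    z                    ∎
    where open ≤-Reasoning
  loc : ∀ {p q} → p < q → Lo p ⊎ Up q
  loc {p} {q} p<q =
    case ℚ.<-dense p<q of λ (t , p<t , t<q) →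
    case ℚ.<-dense t<q of λ (u , t<u , u<q) →
    case t ℚ.≤? 0ℚ of λ where
      (yes t≤0) → inj₁ (lower-neg (ℚ.<-≤-trans p<t t≤0))
      (no  t≰0) → positive-case p<t t<u u<q (ℚ.≰⇒> t≰0)
    where
    positive-case : ∀ {t u} → p < t → t < u → u < q → 0ℚ < t → Lo p ⊎ Up q
    positive-case {t} {u} p<t t<u u<q 0<t =
      case separate (2ℚ * 2ℚ) 0<t t<u of λ (m , lt) →
      case grid x m of λ (j , lj , uj) →
      case ℚ.≤-total (t ^ suc m) (2^ᶻ j) of λ where
        (inj₁ le) → inj₁ (j , m , lj , t , p<t , ℚ.<⇒≤ 0<t , le)
        (inj₂ ge) → inj₂ (+ 2 ℤ.+ j , m , uj , u , u<q , ℚ.<⇒≤ (ℚ.<-trans 0<t t<u) , above j ge lt)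

------------------------------------------------------------------------
-- Stanley–Wilf limits

infix 4 _ConvergesTo_

_ConvergesTo_ : (ℕ → ℝ) → ℝ → Set₁
a ConvergesTo ℓ = ∀ ε → 0ℝ <ℝ ε →
  ∃[ N ] ∀ n → N ℕ.≤ n → ℓ <ℝ a n +ℝ ε × a n <ℝ ℓ +ℝ ε

-- The sequence S_n(π) ^ (1 / n) starts at n = 1.  Its limit L(π) is given by a
-- relation rather than a function: that the limit exists (Marcus–Tardos, Arratia)
-- is not proved here, and constructively a bounded sequence need not have a
-- located supremum.

IsStanleyWilfLimit : ∀ {k} → Permutation′ k → ℝ → Set₁
IsStanleyWilfLimit π L = (λ n → root (suc n) (S π (suc n))) ConvergesTo L

module Submission where

-- Let N = 2 ^ r and give every pair of midpoints of dyadic subintervals of [0 , N) a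
-- random bit that is false with probability 1 / Q, where Q is a multiple of r.  Keep the
-- entry (i , j) of an N × N matrix if all r² pairs of midpoints of intervals around i
-- and around j are true; the expected density is N ^ -ε.  Two indices are separated
-- by a midpoint of a dyadic interval containing both, so if every block of an ℓ × ℓ
-- division of the matrix contained an entry, there would be an all-true ℓ × ℓ rectangle of
-- midpoints, and for ℓ of order r² none is expected.
--
-- A choice of one entry in each of n rows is sorted into an n-permutation, equal columns
-- being ordered by position.  The pattern consists of ℓ increasing runs of positions that
-- meet every one of ℓ decreasing runs of values, so its occurrences would produce such a
-- division.  The choice is recovered from the permutation and an encoding of its
-- column values that costs a factor N ^ ε per point, so n-th roots are at least 2 ^ v with
-- v proportional to r.  Since the pattern starts with its maximum, matrices can be
-- repeated along the diagonal, which makes n arbitrarily large.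

open import Defs
open import Algebra.Bundles using (CommutativeRing)
open import Data.Bool.Base using (Bool; true; false)
open import Data.Fin.Base as Fin
  using (Fin; zero; suc; toℕ; fromℕ<; punchIn; inject≤; combine; remQuot; quotient; remainder; opposite; _↑ʳ_)
open import Data.Fin.Permutation using (Permutation′; permutation; _⟨$⟩ʳ_; _⟨$⟩ˡ_; insert; id; inverseˡ; inverseʳ; _≈_)
import Data.Fin.Properties as Fin
import Data.Integer.Base as ℤ
open import Data.List.Base as List
  using (List; []; _∷_; _++_; map; length; filter; allFin; cartesianProduct; cartesianProductWith)
open import Data.List.Membership.Propositional using (_∈_; find; lose)
open import Data.List.Membership.Propositional.Properties
  using (∈-allFin; ∈-lookup; ∈-filter⁺; ∈-filter⁻; ∈-cartesianProduct⁺; ∈-cartesianProduct⁻;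
         ∈-cartesianProductWith⁺; ∈-cartesianProductWith⁻)
open import Data.List.Properties using (map-cong; length-++; length-map; length-filter; length-tabulate)
open import Data.List.Relation.Unary.All as All using (All; []; _∷_)
open import Data.List.Relation.Unary.AllPairs using (AllPairs; []; _∷_)
import Data.List.Relation.Unary.AllPairs.Properties as AllPairs
open import Data.List.Relation.Unary.Any as Any using (Any; here; there)
import Data.List.Relation.Unary.Any.Properties as Any
open import Data.List.Relation.Unary.Unique.Propositional using (Unique)
import Data.List.Relation.Unary.Unique.Propositional.Properties as Unique
open import Data.Nat
open import Data.Nat.DivMod using (_mod_; m≡m%n+[m/n]*n; m<n⇒m%n≡m; /-monoˡ-≤; m<n*o⇒m/o<n)
open import Data.Nat.ListAction using (sum)
open import Data.Nat.Properties
open import Data.Nat.Solver using (module +-*-Solver)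
open import Data.Product.Base using (_×_; _,_; Σ-syntax; ∃; ∃-syntax; proj₁; proj₂)
open import Data.Rational.Base as ℚ using (ℚ; 0ℚ; 1ℚ)
import Data.Rational.Properties as ℚ
open import Data.Rational.Solver using () renaming (module +-*-Solver to ℚ-Solver)
open import Data.Sum.Base using (_⊎_; inj₁; inj₂)
open import Data.Vec.Base as Vec using (Vec; []; _∷_; lookup; tabulate; replicate; _[_]≔_)
open import Data.Vec.Properties
  using (∷-injective; lookup-map; lookup∘tabulate; tabulate∘lookup; tabulate-cong; lookup-replicate)
open import Function.Base using (_∘_; case_of_)
open import Function.Bundles using (_⇔_; mk⇔; Equivalence)
open import Relation.Binary.Definitions using (tri<; tri≈; tri>)
open import Relation.Binary.PropositionalEquality
open import Relation.Nullary.Decidable using (Dec; yes; no; ¬?; _→-dec_)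
open import Relation.Nullary.Negation using (¬_; contradiction)
open import Relation.Unary using (Decidable)

open import Algebra.Properties.Semiring.Exp (CommutativeRing.semiring ℚ.+-*-commutativeRing)
  using () renaming (_^_ to _^ℚ_)

open ℝ
open RationalLemmas using (fromℕ-suc; 0≤fromℕ; 0<q-p; ^-mono-<)
open Corners using (lower-between²)
open +-*-Solver using (solve; _:=_; _:+_; _:*_; con)

-- Finite sums over lists.

∑ : ∀ {A : Set} → List A → (A → ℕ) → ℕ
∑ xs f = sum (map f xs)

module _ {A : Set} where

  ∑-≤-length* : ∀ xs (f : A → ℕ) {b} → (∀ {x} → x ∈ xs → f x ≤ b) → ∑ xs f ≤ length xs * b
  ∑-≤-length* []       f le = z≤n
  ∑-≤-length* (x ∷ xs) f le = +-mono-≤ (le (here refl)) (∑-≤-length* xs f (le ∘ there))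

  length*-≤-∑ : ∀ xs (f : A → ℕ) {b} → (∀ {x} → x ∈ xs → b ≤ f x) → length xs * b ≤ ∑ xs f
  length*-≤-∑ []       f le = z≤n
  length*-≤-∑ (x ∷ xs) f le = +-mono-≤ (le (here refl)) (length*-≤-∑ xs f (le ∘ there))

  ≤-∑ : ∀ {xs x} (f : A → ℕ) → x ∈ xs → f x ≤ ∑ xs f
  ≤-∑ f (here refl) = m≤m+n _ _
  ≤-∑ f (there x∈)  = ≤-trans (≤-∑ f x∈) (m≤n+m _ _)

  ∑-cong : ∀ xs {f g : A → ℕ} → (∀ x → f x ≡ g x) → ∑ xs f ≡ ∑ xs g
  ∑-cong xs eq = cong sum (map-cong eq xs)

  ∑-*ʳ : ∀ xs (f : A → ℕ) b → ∑ xs (λ x → f x * b) ≡ ∑ xs f * b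
  ∑-*ʳ []       f b = refl
  ∑-*ʳ (x ∷ xs) f b = trans (cong (f x * b +_) (∑-*ʳ xs f b)) (sym (*-distribʳ-+ b (f x) (∑ xs f)))

  module _ {P : A → Set} (P? : Decidable P) (f : A → ℕ) where

    ∑-≤-filter : ∀ xs {a b} → (∀ x → f x ≤ a) → (∀ x → ¬ P x → f x ≤ b) →
                 ∑ xs f ≤ length (filter P? xs) * a + length xs * b
    ∑-≤-filter []       fa fb = z≤n
    ∑-≤-filter (x ∷ xs) {a} {b} fa fb with P? x
    ... | yes _  = begin
      f x + ∑ xs f                  ≤⟨ +-mono-≤ (fa x) (∑-≤-filter xs fa fb) ⟩
      a + (F * a + L * b)           ≤⟨ m≤n+m _ b ⟩
      b + (a + (F * a + L * b))     ≡⟨ solve 4 (λ a b c d → b :+ (a :+ (c :+ d)) := a :+ c :+ (b :+ d)) refl a b (F * a) (L * b) ⟩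
      a + F * a + (b + L * b)       ∎
      where open ≤-Reasoning ; F = length (filter P? xs) ; L = length xs
    ... | no  ¬p = begin
      f x + ∑ xs f                  ≤⟨ +-mono-≤ (fb x ¬p) (∑-≤-filter xs fa fb) ⟩
      b + (F * a + L * b)           ≡⟨ solve 3 (λ b c d → b :+ (c :+ d) := c :+ (b :+ d)) refl b (F * a) (L * b) ⟩
      F * a + (b + L * b)           ∎
      where open ≤-Reasoning ; F = length (filter P? xs) ; L = length xs

^-distribʳ-* : ∀ k m n → (m * n) ^ k ≡ m ^ k * n ^ k
^-distribʳ-* zero    m n = refl
^-distribʳ-* (suc k) m n = trans (cong (m * n *_) (^-distribʳ-* k m n))
  (solve 4 (λ m n x y → m :* n :* (x :* y) := m :* x :* (n :* y)) refl m n (m ^ k) (n ^ k))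

-- Weighted counting over vectors of independent bits.

⟦_⟧ : Bool → ℕ
⟦ false ⟧ = 0
⟦ true ⟧  = 1

allTrue : ∀ {n} → List (Fin n) → Vec Bool n → ℕ
allTrue []       χ = 1
allTrue (x ∷ xs) χ = ⟦ lookup χ x ⟧ * allTrue xs χ

⟦⟧≤1 : ∀ b → ⟦ b ⟧ ≤ 1
⟦⟧≤1 false = z≤n
⟦⟧≤1 true  = ≤-refl

allTrue≤1 : ∀ {n} xs (χ : Vec Bool n) → allTrue xs χ ≤ 1
allTrue≤1 []       χ = ≤-refl
allTrue≤1 (x ∷ xs) χ = *-mono-≤ (⟦⟧≤1 (lookup χ x)) (allTrue≤1 xs χ)

allTrue⇒1 : ∀ {n} xs (χ : Vec Bool n) → (∀ {x} → x ∈ xs → lookup χ x ≡ true) → allTrue xs χ ≡ 1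
allTrue⇒1 []       χ t = refl
allTrue⇒1 (x ∷ xs) χ t = cong₂ _*_ (cong ⟦_⟧ (t (here refl))) (allTrue⇒1 xs χ (t ∘ there))

1⇒allTrue : ∀ {n} xs (χ : Vec Bool n) → 1 ≤ allTrue xs χ → ∀ {x} → x ∈ xs → lookup χ x ≡ true
1⇒allTrue (y ∷ xs) χ le x∈ with lookup χ y in eq
1⇒allTrue (y ∷ xs) χ le (here refl) | true = eq
1⇒allTrue (y ∷ xs) χ le (there x∈)  | true = 1⇒allTrue xs χ (subst (1 ≤_) (*-identityˡ _) le) x∈

⟦⟧-mono : ∀ {n} (χ : Vec Bool n) x y → ⟦ lookup (χ [ x ]≔ false) y ⟧ ≤ ⟦ lookup (χ [ x ]≔ true) y ⟧
⟦⟧-mono (b ∷ χ) zero    zero    = z≤n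
⟦⟧-mono (b ∷ χ) zero    (suc y) = ≤-refl
⟦⟧-mono (b ∷ χ) (suc x) zero    = ≤-refl
⟦⟧-mono (b ∷ χ) (suc x) (suc y) = ⟦⟧-mono χ x y

allTrue-mono : ∀ {n} (χ : Vec Bool n) x xs → allTrue xs (χ [ x ]≔ false) ≤ allTrue xs (χ [ x ]≔ true)
allTrue-mono χ x []       = ≤-refl
allTrue-mono χ x (y ∷ xs) = *-mono-≤ (⟦⟧-mono χ x y) (allTrue-mono χ x xs)

lookup-other : ∀ {n} (χ : Vec Bool n) {x y} → x ≢ y → lookup (χ [ x ]≔ true) y ≡ lookup (χ [ x ]≔ false) y
lookup-other (b ∷ χ) {zero}  {zero}  x≢y = contradiction refl x≢y
lookup-other (b ∷ χ) {zero}  {suc y} x≢y = refl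
lookup-other (b ∷ χ) {suc x} {zero}  x≢y = refl
lookup-other (b ∷ χ) {suc x} {suc y} x≢y = lookup-other χ (x≢y ∘ cong suc)

allTrue-other : ∀ {n} (χ : Vec Bool n) {x xs} → All (x ≢_) xs →
                allTrue xs (χ [ x ]≔ true) ≡ allTrue xs (χ [ x ]≔ false)
allTrue-other χ []        = refl
allTrue-other χ (x≢ ∷ ps) = cong₂ _*_ (cong ⟦_⟧ (lookup-other χ x≢)) (allTrue-other χ ps)

-- Total weight of f when true weighs p and false weighs 1: the expectation of f
-- over independent bits that are false with probability 1 / (1 + p), scaled by
-- (1 + p) ^ n.
module Weighting (p : ℕ) where

  E : ∀ n → (Vec Bool n → ℕ) → ℕ
  E zero    f = f []
  E (suc n) f = E n (f ∘ (false ∷_)) + p * E n (f ∘ (true ∷_))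

  E-mono-≤ : ∀ n {f g} → (∀ χ → f χ ≤ g χ) → E n f ≤ E n g
  E-mono-≤ zero    le = le []
  E-mono-≤ (suc n) le = +-mono-≤ (E-mono-≤ n (le ∘ (false ∷_))) (*-monoʳ-≤ p (E-mono-≤ n (le ∘ (true ∷_))))

  E-+ : ∀ n f g → E n (λ χ → f χ + g χ) ≡ E n f + E n g
  E-+ zero    f g = refl
  E-+ (suc n) f g = trans
    (cong₂ (λ a b → a + p * b) (E-+ n (f ∘ (false ∷_)) _) (E-+ n (f ∘ (true ∷_)) _))
    (solve 5 (λ a b c d p → (a :+ b) :+ p :* (c :+ d) := a :+ p :* c :+ (b :+ p :* d)) refl
      (E n (f ∘ (false ∷_))) _ (E n (f ∘ (true ∷_))) _ p)

  E-const : ∀ n c → E n (λ _ → c) ≡ c * suc p ^ n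
  E-const zero    c = sym (*-identityʳ c)
  E-const (suc n) c = trans (cong (λ a → a + p * a) (E-const n c))
    (solve 3 (λ c p x → c :* x :+ p :* (c :* x) := c :* ((con 1 :+ p) :* x)) refl c p (suc p ^ n))

  E-∑ : ∀ n {A : Set} (xs : List A) (f : A → Vec Bool n → ℕ) →
        E n (λ χ → ∑ xs (λ x → f x χ)) ≡ ∑ xs (λ x → E n (f x))
  E-∑ n []       f = E-const n 0
  E-∑ n (x ∷ xs) f = trans (E-+ n (f x) _) (cong (E n (f x) +_) (E-∑ n xs f))

  E-*ʳ : ∀ n f c → E n (λ χ → f χ * c) ≡ E n f * c
  E-*ʳ zero    f c = refl
  E-*ʳ (suc n) f c = trans
    (cong₂ (λ a b → a + p * b) (E-*ʳ n (f ∘ (false ∷_)) c) (E-*ʳ n (f ∘ (true ∷_)) c))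
    (solve 4 (λ a b c p → a :* c :+ p :* (b :* c) := (a :+ p :* b) :* c) refl
      (E n (f ∘ (false ∷_))) (E n (f ∘ (true ∷_))) c p)

  E-0* : ∀ n (f : Vec Bool n → ℕ) → E n (λ χ → 0 * f χ) ≡ 0
  E-0* n f = E-const n 0

  E-1* : ∀ n (f : Vec Bool n → ℕ) → E n (λ χ → 1 * f χ) ≡ E n f
  E-1* zero    f = *-identityˡ _
  E-1* (suc n) f = cong₂ (λ a b → a + p * b) (E-1* n _) (E-1* n _)

  E-bit-zero : ∀ n (f : Vec Bool (suc n) → ℕ) → E (suc n) (λ χ → ⟦ lookup χ zero ⟧ * f χ) ≡ p * E n (f ∘ (true ∷_))
  E-bit-zero n f = cong₂ (λ a b → a + p * b) (E-0* n (f ∘ (false ∷_))) (E-1* n (f ∘ (true ∷_)))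

  rearrange : ∀ a b → suc p * (a + p * b) ≡ suc p * a + p * (suc p * b)
  rearrange a b = solve 3 (λ p a b → (con 1 :+ p) :* (a :+ p :* b) := (con 1 :+ p) :* a :+ p :* ((con 1 :+ p) :* b)) refl p a b

  rearrange′ : ∀ a b → p * (a + p * b) ≡ p * a + p * (p * b)
  rearrange′ a b = solve 3 (λ p a b → p :* (a :+ p :* b) := p :* a :+ p :* (p :* b)) refl p a b

  -- The one-bit case of the Harris correlation inequality: making bit `x` true can only increase
  -- `f`, so conditioning on it does not lower the mean.
  E-bit-≥ : ∀ n x (f : Vec Bool n → ℕ) → (∀ χ → f (χ [ x ]≔ false) ≤ f (χ [ x ]≔ true)) →
            p * E n f ≤ suc p * E n (λ χ → ⟦ lookup χ x ⟧ * f χ)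
  E-bit-≥ (suc n) zero f mono = begin
    p * (a + p * b)       ≤⟨ *-monoʳ-≤ p (+-monoˡ-≤ (p * b) (E-mono-≤ n λ χ → mono (false ∷ χ))) ⟩
    p * (b + p * b)       ≡⟨ solve 2 (λ p b → p :* (b :+ p :* b) := (con 1 :+ p) :* (p :* b)) refl p b ⟩
    suc p * (p * b)       ≡⟨ cong (suc p *_) (E-bit-zero n f) ⟨
    suc p * E (suc n) (λ χ → ⟦ lookup χ zero ⟧ * f χ) ∎
    where open ≤-Reasoning ; a = E n (f ∘ (false ∷_)) ; b = E n (f ∘ (true ∷_))
  E-bit-≥ (suc n) (suc x) f mono = subst₂ _≤_ (sym (rearrange′ _ _)) (sym (rearrange _ _))
    (+-mono-≤ (E-bit-≥ n x (f ∘ (false ∷_)) (mono ∘ (false ∷_)))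
              (*-monoʳ-≤ p (E-bit-≥ n x (f ∘ (true ∷_)) (mono ∘ (true ∷_)))))

  E-bit-≤ : ∀ n x (f : Vec Bool n → ℕ) → (∀ χ → f (χ [ x ]≔ true) ≤ f (χ [ x ]≔ false)) →
            suc p * E n (λ χ → ⟦ lookup χ x ⟧ * f χ) ≤ p * E n f
  E-bit-≤ (suc n) zero f anti = begin
    suc p * E (suc n) (λ χ → ⟦ lookup χ zero ⟧ * f χ) ≡⟨ cong (suc p *_) (E-bit-zero n f) ⟩
    suc p * (p * b)       ≡⟨ solve 2 (λ p b → p :* (b :+ p :* b) := (con 1 :+ p) :* (p :* b)) refl p b ⟨
    p * (b + p * b)       ≤⟨ *-monoʳ-≤ p (+-monoˡ-≤ (p * b) (E-mono-≤ n λ χ → anti (false ∷ χ))) ⟩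
    p * (a + p * b)       ∎
    where open ≤-Reasoning ; a = E n (f ∘ (false ∷_)) ; b = E n (f ∘ (true ∷_))
  E-bit-≤ (suc n) (suc x) f anti = subst₂ _≤_ (sym (rearrange _ _)) (sym (rearrange′ _ _))
    (+-mono-≤ (E-bit-≤ n x (f ∘ (false ∷_)) (anti ∘ (false ∷_)))
              (*-monoʳ-≤ p (E-bit-≤ n x (f ∘ (true ∷_)) (anti ∘ (true ∷_)))))

  -- Each further bit is positively correlated with the remaining product, because that product is
  -- monotone in it; a repeated bit only raises the probability.
  E-allTrue-≥ : ∀ n xs → p ^ length xs * suc p ^ n ≤ suc p ^ length xs * E n (allTrue xs)
  E-allTrue-≥ n []       = ≤-reflexive (cong (1 *_) (trans (sym (*-identityˡ _)) (sym (E-const n 1))))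
  E-allTrue-≥ n (x ∷ xs) = begin
    p * p ^ L * Q ^ n                  ≡⟨ *-assoc p (p ^ L) (Q ^ n) ⟩
    p * (p ^ L * Q ^ n)                ≤⟨ *-monoʳ-≤ p (E-allTrue-≥ n xs) ⟩
    p * (Q ^ L * E n (allTrue xs))     ≡⟨ solve 3 (λ p a b → p :* (a :* b) := a :* (p :* b)) refl p (Q ^ L) (E n (allTrue xs)) ⟩
    Q ^ L * (p * E n (allTrue xs))     ≤⟨ *-monoʳ-≤ (Q ^ L) (E-bit-≥ n x (allTrue xs) λ χ → allTrue-mono χ x xs) ⟩
    Q ^ L * (Q * E n (allTrue (x ∷ xs)))   ≡⟨ solve 3 (λ a q b → a :* (q :* b) := q :* a :* b) refl (Q ^ L) Q (E n (allTrue (x ∷ xs))) ⟩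
    Q * Q ^ L * E n (allTrue (x ∷ xs)) ∎
    where open ≤-Reasoning ; L = length xs ; Q = suc p

  -- Distinct bits are independent: by uniqueness, the bit that is split off does not occur in the
  -- remaining product.
  E-allTrue-≤ : ∀ n {xs} → Unique xs → suc p ^ length xs * E n (allTrue xs) ≤ p ^ length xs * suc p ^ n
  E-allTrue-≤ n []                   = ≤-reflexive (cong (1 *_) (trans (E-const n 1) (*-identityˡ _)))
  E-allTrue-≤ n (_∷_ {x} {xs} x∉ u) = begin
    Q * Q ^ L * E n (allTrue (x ∷ xs)) ≡⟨ solve 3 (λ a q b → a :* (q :* b) := q :* a :* b) refl (Q ^ L) Q (E n (allTrue (x ∷ xs))) ⟨
    Q ^ L * (Q * E n (allTrue (x ∷ xs)))   ≤⟨ *-monoʳ-≤ (Q ^ L) (E-bit-≤ n x (allTrue xs) λ χ → ≤-reflexive (allTrue-other χ x∉)) ⟩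
    Q ^ L * (p * E n (allTrue xs))     ≡⟨ solve 3 (λ p a b → p :* (a :* b) := a :* (p :* b)) refl p (Q ^ L) (E n (allTrue xs)) ⟨
    p * (Q ^ L * E n (allTrue xs))     ≤⟨ *-monoʳ-≤ p (E-allTrue-≤ n u) ⟩
    p * (p ^ L * Q ^ n)                ≡⟨ *-assoc p (p ^ L) (Q ^ n) ⟨
    p * p ^ L * Q ^ n                  ∎
    where open ≤-Reasoning ; L = length xs ; Q = suc p

  exceeds-or-below : ∀ n (f g : Vec Bool n → ℕ) → (∃[ χ ] g χ < f χ) ⊎ (∀ χ → f χ ≤ g χ)
  exceeds-or-below zero f g with g [] <? f []
  ... | yes lt = inj₁ ([] , lt)
  ... | no  ≮  = inj₂ λ { [] → ≮⇒≥ ≮ }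
  exceeds-or-below (suc n) f g with exceeds-or-below n (f ∘ (false ∷_)) (g ∘ (false ∷_))
                                  | exceeds-or-below n (f ∘ (true ∷_)) (g ∘ (true ∷_))
  ... | inj₁ (χ , lt) | _             = inj₁ (false ∷ χ , lt)
  ... | inj₂ _        | inj₁ (χ , lt) = inj₁ (true ∷ χ , lt)
  ... | inj₂ le       | inj₂ le′      = inj₂ λ { (false ∷ χ) → le χ ; (true ∷ χ) → le′ χ }

  -- The probabilistic method: a strict comparison of expectations yields an outcome with the same
  -- strict comparison.
  E-<⇒∃ : ∀ n f g → E n g < E n f → ∃[ χ ] g χ < f χ
  E-<⇒∃ n f g lt with exceeds-or-below n f g
  ... | inj₁ found = found
  ... | inj₂ le    = contradiction lt (≤⇒≯ (E-mono-≤ n le))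

-- Estimates of (1 - 1/Q)^Q in natural numbers.

-- (1 - 1/Q)^Q ≤ 1/2
2p^Q≤Q^Q : ∀ p → 2 * p ^ suc p ≤ suc p ^ suc p
2p^Q≤Q^Q zero = z≤n
2p^Q≤Q^Q p@(suc _) = *-cancelˡ-≤ p (begin
  p * (2 * p ^ suc p)         ≡⟨ solve 2 (λ p x → p :* (con 2 :* x) := (p :+ p) :* x) refl p (p ^ suc p) ⟩
  (p + p) * p ^ suc p         ≤⟨ *-monoˡ-≤ (p ^ suc p) (+-monoʳ-≤ p (n≤1+n p)) ⟩
  (p + suc p) * p ^ suc p     ≤⟨ bern (suc p) ⟩
  p * suc p ^ suc p           ∎)
  where
  open ≤-Reasoning
  -- Bernoulli's inequality (1 + 1/p)^n ≥ 1 + n/p without denominators; at n = p + 1 the right-hand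
  -- side exceeds 2.
  bern : ∀ n → (p + n) * p ^ n ≤ p * suc p ^ n
  bern zero    = ≤-reflexive (cong (_* 1) (+-identityʳ p))
  bern (suc n) = begin
    (p + suc n) * (p * p ^ n)            ≤⟨ m≤m+n _ (n * p ^ n) ⟩
    (p + suc n) * (p * p ^ n) + n * p ^ n
      ≡⟨ solve 3 (λ p n x → (p :+ (con 1 :+ n)) :* (p :* x) :+ n :* x := (con 1 :+ p) :* ((p :+ n) :* x)) refl p n (p ^ n) ⟩
    suc p * ((p + n) * p ^ n)            ≤⟨ *-monoʳ-≤ (suc p) (bern n) ⟩
    suc p * (p * suc p ^ n)              ≡⟨ solve 3 (λ p q x → q :* (p :* x) := p :* (q :* x)) refl p (suc p) (suc p ^ n) ⟩
    p * (suc p * suc p ^ n)              ∎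

-- (1 - 1/Q)^n ≥ 1 - n/Q, without subtraction
bernoulli′ : ∀ p n → suc p * suc p ^ n ≤ suc p * p ^ n + n * suc p ^ n
bernoulli′ p zero    = ≤-reflexive (sym (+-identityʳ _))
bernoulli′ p (suc n) = begin
  Q * (Q * x)                          ≡⟨ cong (λ t → Q * (t * x)) (+-comm 1 p) ⟩
  Q * ((p + 1) * x)                    ≡⟨ solve 3 (λ q p x → q :* ((p :+ con 1) :* x) := p :* (q :* x) :+ q :* x) refl Q p x ⟩
  p * (Q * x) + Q * x                  ≤⟨ +-monoˡ-≤ (Q * x) (*-monoʳ-≤ p (bernoulli′ p n)) ⟩
  p * (Q * y + n * x) + Q * x          ≡⟨ solve 5 (λ p q x y n → p :* (q :* y :+ n :* x) :+ q :* x
                                                                  := q :* (p :* y) :+ (q :* x :+ n :* (p :* x))) refl p Q x y n ⟩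
  Q * (p * y) + (Q * x + n * (p * x))  ≤⟨ +-monoʳ-≤ (Q * (p * y)) (+-monoʳ-≤ (Q * x) (*-monoʳ-≤ n (*-monoˡ-≤ x (n≤1+n p)))) ⟩
  Q * (p * y) + suc n * (Q * x)        ∎
  where open ≤-Reasoning ; Q = suc p ; x = suc p ^ n ; y = p ^ n

-- At exponent m = Q/2, Bernoulli's inequality gives (1 - 1/Q)^m ≥ 1/2, and squaring gives (1 -
-- 1/Q)^Q ≥ 1/4.
Q^Q≤4p^Q : ∀ p m → suc p ≡ m + m → suc p ^ suc p ≤ 4 * p ^ suc p
Q^Q≤4p^Q p zero ()
Q^Q≤4p^Q p m@(suc _) eq = begin
  Q ^ Q                         ≡⟨ split Q ⟩
  Q ^ m * Q ^ m                 ≤⟨ *-mono-≤ half half ⟩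
  (2 * p ^ m) * (2 * p ^ m)     ≡⟨ solve 1 (λ x → (con 2 :* x) :* (con 2 :* x) := con 4 :* (x :* x)) refl (p ^ m) ⟩
  4 * (p ^ m * p ^ m)           ≡⟨ cong (4 *_) (split p) ⟨
  4 * p ^ Q                     ∎
  where
  open ≤-Reasoning
  Q = suc p
  split : ∀ b → b ^ Q ≡ b ^ m * b ^ m
  split b = trans (cong (b ^_) eq) (^-distribˡ-+-* b m m)
  half : Q ^ m ≤ 2 * p ^ m
  half = *-cancelˡ-≤ m (+-cancelʳ-≤ (m * Q ^ m) _ _ (begin
    m * Q ^ m + m * Q ^ m              ≡⟨ *-distribʳ-+ (Q ^ m) m m ⟨
    (m + m) * Q ^ m                    ≡⟨ cong (_* Q ^ m) eq ⟨
    Q * Q ^ m                          ≤⟨ bernoulli′ p m ⟩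
    Q * p ^ m + m * Q ^ m              ≡⟨ cong (λ t → t * p ^ m + m * Q ^ m) eq ⟩
    (m + m) * p ^ m + m * Q ^ m        ≡⟨ cong (_+ m * Q ^ m) (solve 2 (λ m x → (m :+ m) :* x := m :* (con 2 :* x)) refl m (p ^ m)) ⟩
    m * (2 * p ^ m) + m * Q ^ m        ∎))

-- Enumerating choices, and counting by codes.

length-cartesianProductWith : ∀ {A B C : Set} (f : A → B → C) xs ys →
  length (cartesianProductWith f xs ys) ≡ length xs * length ys
length-cartesianProductWith f []       ys = refl
length-cartesianProductWith f (x ∷ xs) ys = trans (length-++ (map (f x) ys))
  (cong₂ _+_ (length-map (f x) ys) (length-cartesianProductWith f xs ys))

module _ {A : Set} where

  choices : ∀ {n} → Vec (List A) n → List (Vec A n)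
  choices []         = [] ∷ []
  choices (xs ∷ xss) = cartesianProductWith _∷_ xs (choices xss)

  choices-unique : ∀ {n} (xss : Vec (List A) n) → (∀ i → Unique (lookup xss i)) → Unique (choices xss)
  choices-unique []         u = [] ∷ []
  choices-unique (xs ∷ xss) u =
    Unique.cartesianProductWith⁺ _∷_ ∷-injective (u zero) (choices-unique xss (u ∘ suc))

  ∈-choices⁺ : ∀ {n} (xss : Vec (List A) n) v → (∀ i → lookup v i ∈ lookup xss i) → v ∈ choices xss
  ∈-choices⁺ []         []      v∈ = here refl
  ∈-choices⁺ (xs ∷ xss) (x ∷ v) v∈ = ∈-cartesianProductWith⁺ _∷_ (v∈ zero) (∈-choices⁺ xss v (v∈ ∘ suc))

  ∈-choices⁻ : ∀ {n} (xss : Vec (List A) n) {v} → v ∈ choices xss → ∀ i → lookup v i ∈ lookup xss i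
  ∈-choices⁻ (xs ∷ xss) v∈ i with ∈-cartesianProductWith⁻ _∷_ xs (choices xss) v∈
  ∈-choices⁻ (xs ∷ xss) v∈ zero    | _ , _ , x∈ , w∈ , refl = x∈
  ∈-choices⁻ (xs ∷ xss) v∈ (suc i) | _ , _ , x∈ , w∈ , refl = ∈-choices⁻ xss w∈ i

  length-choices-≥ : ∀ {n d} (xss : Vec (List A) n) → (∀ i → d ≤ length (lookup xss i)) → d ^ n ≤ length (choices xss)
  length-choices-≥ []         d≤ = ≤-refl
  length-choices-≥ (xs ∷ xss) d≤ = ≤-trans (*-mono-≤ (d≤ zero) (length-choices-≥ xss (d≤ ∘ suc)))
    (≤-reflexive (sym (length-cartesianProductWith _∷_ xs (choices xss))))

  length-choices-≤ : ∀ {n d} (xss : Vec (List A) n) → (∀ i → length (lookup xss i) ≤ d) → length (choices xss) ≤ d ^ n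
  length-choices-≤ []         ≤d = ≤-refl
  length-choices-≤ (xs ∷ xss) ≤d = ≤-trans
    (≤-reflexive (length-cartesianProductWith _∷_ xs (choices xss)))
    (*-mono-≤ (≤d zero) (length-choices-≤ xss (≤d ∘ suc)))

  AllPairs-lookup : ∀ {R : A → A → Set} {xs} → AllPairs R xs → ∀ {i j} → i Fin.< j →
                    R (List.lookup xs i) (List.lookup xs j)
  AllPairs-lookup (r ∷ rs) {zero}  {suc j} i<j       = All.lookup r (∈-lookup j)
  AllPairs-lookup (r ∷ rs) {suc i} {suc j} (s≤s i<j) = AllPairs-lookup rs i<j

  Unique-lookup-injective : ∀ {xs : List A} → Unique xs → ∀ {i j} →
                            List.lookup xs i ≡ List.lookup xs j → i ≡ j
  Unique-lookup-injective u {i} {j} eq with Fin.<-cmp i j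
  ... | tri< i<j _ _ = contradiction eq (AllPairs-lookup u i<j)
  ... | tri≈ _ i≡j _ = i≡j
  ... | tri> _ _ j<i = contradiction (sym eq) (AllPairs-lookup u j<i)

  -- A code determines what it encodes, so the index of a code is an injective function of the index
  -- of the element. Coding is a relation because a permutation is found in a list only up to `≈`.
  length-≤-codes : ∀ {B : Set₀} {R : A → B → Set} {xs ys} → Unique xs →
    (∀ {x} → x ∈ xs → Any (R x) ys) → (∀ {x x′ y} → R x y → R x′ y → x ≡ x′) → length xs ≤ length ys
  length-≤-codes {R = R} {xs} {ys} u code inj = Fin.injective⇒≤ {f = index} λ {i} {j} eq →
    Unique-lookup-injective u (inj
      (Any.lookup-result (code (∈-lookup i)))
      (subst (R (List.lookup xs j))
        (trans (sym (lookup-index (code (∈-lookup j)))) (trans (cong (List.lookup ys) (sym eq)) (lookup-index (code (∈-lookup i)))))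
        (Any.lookup-result (code (∈-lookup j)))))
    where
    index : Fin (length xs) → Fin (length ys)
    index i = Any.index (code (∈-lookup i))
    lookup-index : ∀ {P : _ → Set} {ys} (p : Any P ys) → List.lookup ys (Any.index p) ≡ Any.lookup p
    lookup-index (here _)  = refl
    lookup-index (there p) = lookup-index p

-- Bounded monotone sequences as lattice paths.

-- A path of n right steps and m up steps records the heights of its right steps.
monotone : ∀ n → ℕ → List (Vec ℕ n)
monotone zero    m       = [] ∷ []
monotone (suc n) zero    = map (0 ∷_) (monotone n zero)
monotone (suc n) (suc m) = map (0 ∷_) (monotone n (suc m)) ++ map (Vec.map suc) (monotone (suc n) m)

length-monotone : ∀ n m → length (monotone n m) ≤ 2 ^ (n + m)
length-monotone zero    m       = m^n>0 2 m
length-monotone (suc n) zero    = begin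
  length (map (0 ∷_) (monotone n zero))  ≡⟨ length-map (0 ∷_) (monotone n zero) ⟩
  length (monotone n zero)               ≤⟨ length-monotone n zero ⟩
  2 ^ (n + zero)                         ≤⟨ ^-monoʳ-≤ 2 (n≤1+n (n + zero)) ⟩
  2 ^ (suc n + zero)                     ∎
  where open ≤-Reasoning
length-monotone (suc n) (suc m) = begin
  length (map (0 ∷_) (monotone n (suc m)) ++ map (Vec.map suc) (monotone (suc n) m))
    ≡⟨ length-++ (map (0 ∷_) (monotone n (suc m))) ⟩
  length (map (0 ∷_) (monotone n (suc m))) + length (map (Vec.map suc) (monotone (suc n) m))
    ≡⟨ cong₂ _+_ (length-map (0 ∷_) (monotone n (suc m))) (length-map (Vec.map suc) (monotone (suc n) m)) ⟩
  length (monotone n (suc m)) + length (monotone (suc n) m)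
    ≤⟨ +-mono-≤ (length-monotone n (suc m)) (length-monotone (suc n) m) ⟩
  2 ^ (n + suc m) + 2 ^ (suc n + m)      ≡⟨ cong (2 ^ (n + suc m) +_) (trans (cong (2 ^_) (sym (+-suc n m))) (sym (+-identityʳ (2 ^ (n + suc m))))) ⟩
  2 ^ (suc n + suc m)                    ∎
  where open ≤-Reasoning

-- The path of `g` starts with a right step if the first value is zero. Otherwise it starts with an
-- up step, and all values, being at least the first, can be lowered by one.
monotone-complete : ∀ n m (g : Fin n → ℕ) → (∀ {i j} → i Fin.≤ j → g i ≤ g j) → (∀ i → g i ≤ m) →
                    Any (λ v → ∀ i → lookup v i ≡ g i) (monotone n m)
monotone-complete zero m g mono ≤m = here λ ()
monotone-complete (suc n) m g mono ≤m with g zero in eq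
monotone-complete (suc n) zero g mono ≤m | zero = Any.map⁺ (Any.map
  (λ { r zero → sym eq ; r (suc i) → r i })
  (monotone-complete n zero (g ∘ suc) (mono ∘ s≤s) (≤m ∘ suc)))
monotone-complete (suc n) (suc m) g mono ≤m | zero = Any.++⁺ˡ (Any.map⁺ (Any.map
  (λ { r zero → sym eq ; r (suc i) → r i })
  (monotone-complete n (suc m) (g ∘ suc) (mono ∘ s≤s) (≤m ∘ suc))))
monotone-complete (suc n) zero g mono ≤m | suc g₀ = contradiction (≤m zero) (<⇒≱ (subst (0 <_) (sym eq) z<s))
monotone-complete (suc n) (suc m) g mono ≤m | suc g₀ = Any.++⁺ʳ (map (0 ∷_) (monotone n (suc m)))
  (Any.map⁺ (Any.map
    (λ {v} r i → trans (lookup-map i suc v) (trans (cong suc (r i)) (suc-pred (g i) {{positive i}})))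
    (monotone-complete (suc n) m (pred ∘ g) (pred-mono-≤ ∘ mono) (pred-mono-≤ ∘ ≤m))))
  where
  positive : ∀ i → NonZero (g i)
  positive i = >-nonZero (<-≤-trans (subst (0 <_) (sym eq) z<s) (mono {zero} {i} z≤n))

-- Sorting by keys, with ties broken by position.

threshold : ∀ n {P : Fin n → Set} → Decidable P → (∀ {i j} → i Fin.≤ j → P j → P i) →
            ∃[ x ] (∀ i → P i → toℕ i < toℕ {suc n} x) × (∀ i → ¬ P i → toℕ x ≤ toℕ i)
threshold zero    P? down = zero , (λ ()) , (λ ())
threshold (suc n) P? down with P? zero
... | no  ¬p = zero , (λ i pi → contradiction (down z≤n pi) ¬p) , (λ i _ → z≤n)
... | yes p  with threshold n (P? ∘ suc) (down ∘ s≤s)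
...   | x , lo , hi = suc x , (λ { zero _ → z<s ; (suc i) pi → s≤s (lo i pi) })
                            , (λ { zero ¬p → contradiction p ¬p ; (suc i) ¬pi → s≤s (hi i ¬pi) })

punchIn-below : ∀ {n} (x : Fin (suc n)) i → toℕ i < toℕ x → toℕ (punchIn x i) < toℕ x
punchIn-below (suc x) zero    _        = z<s
punchIn-below (suc x) (suc i) (s≤s lt) = s≤s (punchIn-below x i lt)

punchIn-above : ∀ {n} (x : Fin (suc n)) i → toℕ x ≤ toℕ i → toℕ x < toℕ (punchIn x i)
punchIn-above zero    i       _        = z<s
punchIn-above (suc x) (suc i) (s≤s le) = s≤s (punchIn-above x i le)

punchIn-mono-< : ∀ {n} (x : Fin (suc n)) {i j} → i Fin.< j → punchIn x i Fin.< punchIn x j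
punchIn-mono-< zero    lt = s≤s lt
punchIn-mono-< (suc x) {zero}  {suc j} lt       = z<s
punchIn-mono-< (suc x) {suc i} {suc j} (s≤s lt) = s≤s (punchIn-mono-< x lt)

Before : ∀ {n} → (Fin n → ℕ) → Fin n → Fin n → Set
Before key i j = key i < key j ⊎ (key i ≡ key j × i Fin.< j)

Sorts : ∀ {n} → Permutation′ n → (Fin n → ℕ) → Set
Sorts σ key = ∀ {i j} → Before key i j → σ ⟨$⟩ʳ i Fin.< σ ⟨$⟩ʳ j

module _ {n} {σ : Permutation′ n} {key : Fin n → ℕ} (sorts : Sorts σ key) where

  sorts⇒≤ : ∀ {i j} → σ ⟨$⟩ʳ i Fin.< σ ⟨$⟩ʳ j → key i ≤ key j
  sorts⇒≤ lt = ≮⇒≥ λ gt → <-asym lt (sorts (inj₁ gt))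

  -- Equal keys are sorted in order of position, so an inversion of `σ` can only come from different
  -- keys. This strictness later leaves room for a midpoint between two columns.
  sorts⇒< : ∀ {i j} → j Fin.< i → σ ⟨$⟩ʳ i Fin.< σ ⟨$⟩ʳ j → key i < key j
  sorts⇒< {i} {j} j<i lt with <-cmp (key i) (key j)
  ... | tri< i<j _ _ = i<j
  ... | tri≈ _ eq _  = contradiction (sorts (inj₂ (sym eq , j<i))) (<-asym lt)
  ... | tri> _ _ gt  = contradiction (sorts (inj₁ gt)) (<-asym lt)

  sorts⇒monotone : ∀ {x y} → x Fin.≤ y → key (σ ⟨$⟩ˡ x) ≤ key (σ ⟨$⟩ˡ y)
  sorts⇒monotone {x} {y} x≤y = ≮⇒≥ λ gt → <⇒≱ (sorts (inj₁ gt))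
    (subst₂ Fin._≤_ (sym (inverseʳ σ)) (sym (inverseʳ σ)) x≤y)

-- Insertion sort: the first position is ranked just above the entries of strictly smaller key,
-- hence before the later entries with an equal key.
sorting : ∀ n (key : Fin n → ℕ) → ∃[ σ ] Sorts σ key
sorting zero    key = id , λ { {()} }
sorting (suc n) key with sorting n (key ∘ suc)
... | σ , sorts with threshold n (λ p → key (suc (σ ⟨$⟩ˡ p)) <? key zero)
                      (λ i≤j lt → ≤-<-trans (sorts⇒monotone {σ = σ} sorts i≤j) lt)
...   | x , lo , hi = insert zero x σ , λ {i} {j} → sorts′ i j
  where
  back : ∀ i → key (suc (σ ⟨$⟩ˡ (σ ⟨$⟩ʳ i))) ≡ key (suc i)
  back i = cong (key ∘ suc) (inverseˡ σ)
  above : ∀ j → key zero ≤ key (suc j) → toℕ x < toℕ (punchIn x (σ ⟨$⟩ʳ j))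
  above j le = punchIn-above x _ (hi _ λ lt → <⇒≱ (subst (_< key zero) (back j) lt) le)
  sorts′ : ∀ i j → Before key i j → insert zero x σ ⟨$⟩ʳ i Fin.< insert zero x σ ⟨$⟩ʳ j
  sorts′ zero    zero    (inj₁ lt)       = contradiction lt (<-irrefl refl)
  sorts′ zero    (suc j) (inj₁ lt)       = above j (<⇒≤ lt)
  sorts′ zero    (suc j) (inj₂ (eq , _)) = above j (≤-reflexive eq)
  sorts′ (suc i) zero    (inj₁ lt)       = punchIn-below x _ (lo _ (subst (_< key zero) (sym (back i)) lt))
  sorts′ (suc i) (suc j) (inj₁ lt)       = punchIn-mono-< x (sorts (inj₁ lt))
  sorts′ (suc i) (suc j) (inj₂ (eq , s≤s lt)) = punchIn-mono-< x (sorts (inj₂ (eq , lt)))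

-- Dyadic midpoints.

-- The midpoints of the dyadic subintervals of [b , b + 2 ^ r) that contain z.
cuts : ℕ → ℕ → ℕ → List ℕ
cuts zero    b z = []
cuts (suc r) b z with z <? b + 2 ^ r
... | yes _ = b + 2 ^ r ∷ cuts r b z
... | no  _ = b + 2 ^ r ∷ cuts r (b + 2 ^ r) z

length-cuts : ∀ r b z → length (cuts r b z) ≡ r
length-cuts zero    b z = refl
length-cuts (suc r) b z with z <? b + 2 ^ r
... | yes _ = cong suc (length-cuts r b z)
... | no  _ = cong suc (length-cuts r (b + 2 ^ r) z)

-- The descent ends at the smallest dyadic interval that contains both `x` and `y`. Its midpoint
-- separates them, and it is a cut of every `z` between them because such `z` lie in the same
-- interval.
common-cut : ∀ r {b x y} → b ≤ x → x < y → y < b + 2 ^ r →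
             ∃[ m ] x < m × m ≤ y × (∀ {z} → x ≤ z → z ≤ y → m ∈ cuts r b z)
common-cut zero {b} {x} {y} b≤x x<y y< = contradiction (≤-<-trans b≤x x<y) (≤⇒≯ (s≤s⁻¹ (subst (y <_) (+-comm b 1) y<)))
common-cut (suc r) {b} {x} {y} b≤x x<y y< with y <? b + 2 ^ r | x <? b + 2 ^ r
... | yes y<m | _ = let m , x<m , m≤y , m∈ = common-cut r b≤x x<y y<m in m , x<m , m≤y , λ {z} → left m∈ {z}
  where
  left : ∀ {m} → (∀ {z} → x ≤ z → z ≤ y → m ∈ cuts r b z) → ∀ {z} → x ≤ z → z ≤ y → m ∈ cuts (suc r) b z
  left m∈ {z} x≤z z≤y with z <? b + 2 ^ r
  ... | yes _   = there (m∈ x≤z z≤y)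
  ... | no  z≮m = contradiction (≤-<-trans z≤y y<m) z≮m
... | no y≮m | no x≮m = let m , x<m , m≤y , m∈ = common-cut r (≮⇒≥ x≮m) x<y (subst (y <_) end y<)
  in m , x<m , m≤y , λ {z} → right m∈ {z}
  where
  end : b + 2 ^ suc r ≡ b + 2 ^ r + 2 ^ r
  end = trans (cong (λ a → b + (2 ^ r + a)) (+-identityʳ (2 ^ r))) (sym (+-assoc b (2 ^ r) (2 ^ r)))
  right : ∀ {m} → (∀ {z} → x ≤ z → z ≤ y → m ∈ cuts r (b + 2 ^ r) z) → ∀ {z} → x ≤ z → z ≤ y → m ∈ cuts (suc r) b z
  right m∈ {z} x≤z z≤y with z <? b + 2 ^ r
  ... | yes z<m = contradiction (≤-<-trans x≤z z<m) x≮m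
  ... | no  _   = there (m∈ x≤z z≤y)
... | no y≮m | yes x<m = b + 2 ^ r , x<m , ≮⇒≥ y≮m , λ {z} _ _ → first z
  where
  first : ∀ z → b + 2 ^ r ∈ cuts (suc r) b z
  first z with z <? b + 2 ^ r
  ... | yes _ = here refl
  ... | no  _ = here refl

length-allFin : ∀ n → length (allFin n) ≡ n
length-allFin n = length-tabulate {n = n} (λ i → i)

toℕ-mod : ∀ {m n} .{{_ : NonZero n}} → m < n → toℕ (m mod n) ≡ m
toℕ-mod {m} {n} m<n = trans (Fin.toℕ-fromℕ< _) (m<n⇒m%n≡m m<n)

-- Random colourings of pairs of midpoints and the matrices they define.

module Colouring (r : ℕ) where

  N : ℕ
  N = 2 ^ r

  instance
    N≢0 : NonZero N
    N≢0 = m^n≢0 2 r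

  -- The reductions are only casts: cuts of indices below N are below N.
  position : ℕ → ℕ → Fin (N * N)
  position a b = combine (a mod N) (b mod N)

  cells : ℕ → ℕ → List (Fin (N * N))
  cells i j = cartesianProductWith position (cuts r 0 i) (cuts r 0 j)

  length-cells : ∀ i j → length (cells i j) ≡ r * r
  length-cells i j = trans (length-cartesianProductWith position (cuts r 0 i) (cuts r 0 j))
    (cong₂ _*_ (length-cuts r 0 i) (length-cuts r 0 j))

  Colours : Set
  Colours = Vec Bool (N * N)

  Present : Colours → ℕ → ℕ → Set
  Present χ i j = ∀ {a b} → a ∈ cuts r 0 i → b ∈ cuts r 0 j → lookup χ (position a b) ≡ true

  RectangleFree : ℕ → Colours → Set
  RectangleFree ℓ χ = ∀ (a b : Fin ℓ → ℕ) → (∀ {i j} → i Fin.< j → a i < a j) → (∀ {i j} → i Fin.< j → b i < b j) →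
    (∀ i → a i < N) → (∀ i → b i < N) → ¬ (∀ i j → lookup χ (position (a i) (b j)) ≡ true)

  increasing? : ∀ {ℓ} (v : Vec (Fin N) ℓ) → Dec (∀ i j → i Fin.< j → lookup v i Fin.< lookup v j)
  increasing? v = Fin.all? λ i → Fin.all? λ j → (i Fin.<? j) →-dec (lookup v i Fin.<? lookup v j)

  -- Keeping only increasing tuples makes the ℓ² cells of a rectangle distinct, as the upper bound
  -- for `allTrue` requires.
  sides : ∀ ℓ → List (Vec (Fin N) ℓ)
  sides ℓ = filter increasing? (choices (replicate ℓ (allFin N)))

  length-sides : ∀ ℓ → length (sides ℓ) ≤ N ^ ℓ
  length-sides ℓ = ≤-trans (length-filter increasing? (choices (replicate ℓ (allFin N))))
    (length-choices-≤ (replicate ℓ (allFin N)) λ i →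
      ≤-reflexive (trans (cong length (lookup-replicate i (allFin N))) (length-allFin N)))

  rectangle : ∀ {ℓ} → Vec (Fin N) ℓ × Vec (Fin N) ℓ → List (Fin (N * N))
  rectangle {ℓ} (v , w) = cartesianProductWith (λ i j → combine (lookup v i) (lookup w j)) (allFin ℓ) (allFin ℓ)

  length-rectangle : ∀ {ℓ} (vw : Vec (Fin N) ℓ × Vec (Fin N) ℓ) → length (rectangle vw) ≡ ℓ * ℓ
  length-rectangle {ℓ} (v , w) = trans
    (length-cartesianProductWith (λ i j → combine (lookup v i) (lookup w j)) (allFin ℓ) (allFin ℓ))
    (cong₂ _*_ (length-allFin ℓ) (length-allFin ℓ))

  increasing⇒injective : ∀ {ℓ} {v : Vec (Fin N) ℓ} → (∀ i j → i Fin.< j → lookup v i Fin.< lookup v j) →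
                         ∀ {i j} → lookup v i ≡ lookup v j → i ≡ j
  increasing⇒injective inc {i} {j} eq with Fin.<-cmp i j
  ... | tri< i<j _ _ = contradiction (inc i j i<j) (Fin.<-irrefl eq)
  ... | tri≈ _ i≡j _ = i≡j
  ... | tri> _ _ j<i = contradiction (inc j i j<i) (Fin.<-irrefl (sym eq))

  rectangle-unique : ∀ {ℓ v w} → v ∈ sides ℓ → w ∈ sides ℓ → Unique (rectangle (v , w))
  rectangle-unique {ℓ} {v} {w} v∈ w∈ = Unique.cartesianProductWith⁺ (λ i j → combine (lookup v i) (lookup w j))
    (λ eq → let eq₁ , eq₂ = Fin.combine-injective _ _ _ _ eq in
      increasing⇒injective {v = v} (inc v∈) eq₁ , increasing⇒injective {v = w} (inc w∈) eq₂)
    (Unique.allFin⁺ ℓ) (Unique.allFin⁺ ℓ)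
    where
    inc : ∀ {u} → u ∈ sides ℓ → ∀ i j → i Fin.< j → lookup u i Fin.< lookup u j
    inc u∈ = proj₂ (∈-filter⁻ increasing? {xs = choices (replicate ℓ (allFin N))} u∈)

  rectangles : ∀ ℓ → List (Vec (Fin N) ℓ × Vec (Fin N) ℓ)
  rectangles ℓ = cartesianProduct (sides ℓ) (sides ℓ)

  side : ∀ {ℓ} (a : Fin ℓ → ℕ) → (∀ {i j} → i Fin.< j → a i < a j) → (∀ i → a i < N) →
         ∃[ v ] v ∈ sides ℓ × (∀ i → lookup v i ≡ a i mod N)
  side {ℓ} a inc a<N = v , ∈-filter⁺ increasing? (∈-choices⁺ (replicate ℓ (allFin N)) v
      λ i → subst (lookup v i ∈_) (sym (lookup-replicate i (allFin N))) (∈-allFin (lookup v i)))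
      (λ i j i<j → subst₂ _<_ (sym (toℕ-v i)) (sym (toℕ-v j)) (inc i<j))
    , lookup-v
    where
    v : Vec (Fin N) ℓ
    v = tabulate λ i → a i mod N
    lookup-v : ∀ i → lookup v i ≡ a i mod N
    lookup-v = lookup∘tabulate λ i → a i mod N
    toℕ-v : ∀ i → toℕ (lookup v i) ≡ a i
    toℕ-v i = trans (cong toℕ (lookup-v i)) (toℕ-mod (a<N i))

  count : ∀ ℓ → Colours → ℕ
  count ℓ χ = ∑ (rectangles ℓ) λ vw → allTrue (rectangle vw) χ

  count≡0⇒RectangleFree : ∀ ℓ χ → count ℓ χ ≡ 0 → RectangleFree ℓ χ
  count≡0⇒RectangleFree ℓ χ none a b inc-a inc-b a<N b<N joined with side a inc-a a<N | side b inc-b b<N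
  ... | v , v∈ , v≡ | w , w∈ , w≡ = contradiction
    (subst₂ _≤_ (allTrue⇒1 (rectangle (v , w)) χ all) none (≤-∑ _ (∈-cartesianProduct⁺ v∈ w∈)))
    λ ()
    where
    all : ∀ {x} → x ∈ rectangle (v , w) → lookup χ x ≡ true
    all x∈ with ∈-cartesianProductWith⁻ (λ i j → combine (lookup v i) (lookup w j)) (allFin ℓ) (allFin ℓ) x∈
    ... | i , j , _ , _ , refl = trans (cong (lookup χ) (cong₂ combine (v≡ i) (w≡ j))) (joined i j)

  present? : ∀ (χ : Colours) i (j : Fin N) → Dec (1 ≤ allTrue (cells i (toℕ j)) χ)
  present? χ i j = 1 ≤? allTrue (cells i (toℕ j)) χ

  columns : Colours → ℕ → List (Fin N)
  columns χ i = filter (present? χ i) (allFin N)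

  ∈-columns : ∀ χ i {j} → j ∈ columns χ i → Present χ i (toℕ j)
  ∈-columns χ i {j} j∈ a∈ b∈ = 1⇒allTrue (cells i (toℕ j)) χ
    (proj₂ (∈-filter⁻ (present? χ i) {xs = allFin N} j∈))
    (∈-cartesianProductWith⁺ position a∈ b∈)

  rich? : ∀ d (χ : Colours) (i : Fin N) → Dec (d ≤ length (columns χ (toℕ i)))
  rich? d χ i = d ≤? length (columns χ (toℕ i))

  richRows : ℕ → Colours → List (Fin N)
  richRows d χ = filter (rich? d χ) (allFin N)

  size : Colours → ℕ
  size χ = ∑ (allFin N) λ i → ∑ (allFin N) λ j → allTrue (cells (toℕ i) (toℕ j)) χ

  row-size : ∀ χ i → ∑ (allFin N) (λ j → allTrue (cells i (toℕ j)) χ) ≤ length (columns χ i)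
  row-size χ i = begin
    ∑ (allFin N) (λ j → allTrue (cells i (toℕ j)) χ)
      ≤⟨ ∑-≤-filter (present? χ i) _ (allFin N) (λ j → allTrue≤1 (cells i (toℕ j)) χ) (λ j ≱1 → s≤s⁻¹ (≰⇒> ≱1)) ⟩
    length (columns χ i) * 1 + length (allFin N) * 0 ≡⟨ cong₂ _+_ (*-identityʳ (length (columns χ i))) (*-zeroʳ (length (allFin N))) ⟩
    length (columns χ i) + 0                         ≡⟨ +-identityʳ (length (columns χ i)) ⟩
    length (columns χ i)                             ∎
    where open ≤-Reasoning

  length-columns : ∀ χ i → length (columns χ i) ≤ N
  length-columns χ i = ≤-trans (length-filter (present? χ i) (allFin N)) (≤-reflexive (length-allFin N))

  size≤N² : ∀ χ → size χ ≤ N * N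
  size≤N² χ = begin
    size χ                 ≤⟨ ∑-≤-length* (allFin N) _ (λ {i} _ → ≤-trans (row-size χ (toℕ i)) (length-columns χ (toℕ i))) ⟩
    length (allFin N) * N  ≡⟨ cong (_* N) (length-allFin N) ⟩
    N * N                  ∎
    where open ≤-Reasoning

  -- Rows with fewer than `d` entries account for at most N d entries in all. More than N d entries
  -- remain, and each rich row holds at most N of them.
  rich-rows : ∀ d χ → 2 * (N * d) < size χ → d ≤ length (richRows d χ)
  rich-rows d χ lt = <⇒≤ (*-cancelˡ-< N _ _ (+-cancelʳ-< (N * d) _ _ (begin-strict
    N * d + N * d              ≡⟨ cong (N * d +_) (+-identityʳ (N * d)) ⟨
    2 * (N * d)                <⟨ lt ⟩
    size χ                     ≤⟨ ∑-≤-filter (rich? d χ) _ (allFin N)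
                                    (λ i → ≤-trans (row-size χ (toℕ i)) (length-columns χ (toℕ i)))
                                    (λ i ≱d → ≤-trans (row-size χ (toℕ i)) (<⇒≤ (≰⇒> ≱d))) ⟩
    length (richRows d χ) * N + length (allFin N) * d
      ≡⟨ cong₂ _+_ (*-comm (length (richRows d χ)) N) (cong (_* d) (length-allFin N)) ⟩
    N * length (richRows d χ) + N * d ∎)))
    where open ≤-Reasoning

  -- With Q = p + 1, an entry depends on r² = Q v bits and is present with probability at least
  -- 4^-v. A rectangle has ℓ² = Q w ℓ cells and is all true with probability at most 2^-(w ℓ). The
  -- hypothesis `w-large` beats the 2^(2 r ℓ) possible rectangles with a factor 4 · 4^v to spare,
  -- and `z` is chosen so that 2^z = N / (4 · 4^v).
  module Random {p m v w z ℓ : ℕ} (1≤p : 1 ≤ p) (Q-even : suc p ≡ m + m)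
                (r²≤ : r * r ≡ suc p * v) (ℓ≡ : ℓ ≡ suc p * w)
                (w-large : 2 * r * ℓ + (2 + 2 * v) ≤ w * ℓ) (r≡ : r ≡ z + (2 + 2 * v)) where

    open Weighting p using (E; E-+; E-const; E-∑; E-*ʳ; E-allTrue-≥; E-allTrue-≤; E-<⇒∃)

    private
      instance
        p≢0 : NonZero p
        p≢0 = >-nonZero 1≤p
      Q n W : ℕ
      Q = suc p
      n = N * N
      W = Q ^ n

    E-cells : ∀ i j → W ≤ 4 ^ v * E n (allTrue (cells i j))
    E-cells i j = *-cancelˡ-≤ (p ^ (r * r)) {{m^n≢0 p (r * r)}} (begin
      p ^ (r * r) * W                          ≡⟨ cong (λ t → p ^ t * W) (length-cells i j) ⟨
      p ^ length (cells i j) * W               ≤⟨ E-allTrue-≥ n (cells i j) ⟩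
      Q ^ length (cells i j) * e               ≡⟨ cong (λ t → Q ^ t * e) (trans (length-cells i j) r²≤) ⟩
      Q ^ (Q * v) * e                          ≡⟨ cong (_* e) (^-*-assoc Q Q v) ⟨
      (Q ^ Q) ^ v * e                          ≤⟨ *-monoˡ-≤ e (^-monoˡ-≤ v (Q^Q≤4p^Q p m Q-even)) ⟩
      (4 * p ^ Q) ^ v * e                      ≡⟨ cong (_* e) (^-distribʳ-* v 4 (p ^ Q)) ⟩
      4 ^ v * (p ^ Q) ^ v * e                  ≡⟨ cong (λ t → 4 ^ v * t * e) (trans (^-*-assoc p Q v) (cong (p ^_) (sym r²≤))) ⟩
      4 ^ v * p ^ (r * r) * e                  ≡⟨ solve 3 (λ a b c → a :* b :* c := b :* (a :* c)) refl (4 ^ v) (p ^ (r * r)) e ⟩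
      p ^ (r * r) * (4 ^ v * e)                ∎)
      where open ≤-Reasoning ; e = E n (allTrue (cells i j))

    E-size : N * N * W ≤ 4 ^ v * E n size
    E-size = begin
      N * N * W      ≡⟨ *-assoc N N W ⟩
      N * (N * W)    ≡⟨ cong₂ (λ a b → a * (b * W)) (length-allFin N) (length-allFin N) ⟨
      length (allFin N) * (length (allFin N) * W)
        ≤⟨ length*-≤-∑ (allFin N) _ (λ {i} _ → length*-≤-∑ (allFin N) _ (λ {j} _ → bound i j)) ⟩
      ∑ (allFin N) (λ i → ∑ (allFin N) λ j → e i j * 4 ^ v)   ≡⟨ eq ⟨
      E n (λ χ → size χ * 4 ^ v)               ≡⟨ trans (E-*ʳ n size (4 ^ v)) (*-comm (E n size) (4 ^ v)) ⟩
      4 ^ v * E n size                         ∎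
      where
      open ≤-Reasoning
      a : Fin N → Fin N → Colours → ℕ
      a i j = allTrue (cells (toℕ i) (toℕ j))
      e : Fin N → Fin N → ℕ
      e i j = E n (a i j)
      bound : ∀ i j → W ≤ e i j * 4 ^ v
      bound i j = ≤-trans (E-cells (toℕ i) (toℕ j)) (≤-reflexive (*-comm (4 ^ v) (e i j)))
      eq : E n (λ χ → size χ * 4 ^ v) ≡ ∑ (allFin N) (λ i → ∑ (allFin N) λ j → e i j * 4 ^ v)
      eq = trans (E-*ʳ n size (4 ^ v)) (trans
        (cong (_* 4 ^ v) (trans (E-∑ n (allFin N) (λ i χ → ∑ (allFin N) λ j → a i j χ))
          (∑-cong (allFin N) λ i → E-∑ n (allFin N) (a i))))
        (trans (sym (∑-*ʳ (allFin N) _ (4 ^ v))) (∑-cong (allFin N) λ i → sym (∑-*ʳ (allFin N) (e i) (4 ^ v)))))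

    E-rectangle : ∀ {vw} → vw ∈ rectangles ℓ → E n (allTrue (rectangle vw)) * 2 ^ (w * ℓ) ≤ W
    E-rectangle {vw} vw∈ = *-cancelˡ-≤ (p ^ (ℓ * ℓ)) {{m^n≢0 p (ℓ * ℓ)}} (begin
      p ^ (ℓ * ℓ) * (e * 2 ^ (w * ℓ))          ≡⟨ solve 3 (λ a b c → a :* (b :* c) := c :* a :* b) refl (p ^ (ℓ * ℓ)) e (2 ^ (w * ℓ)) ⟩
      2 ^ (w * ℓ) * p ^ (ℓ * ℓ) * e            ≡⟨ cong (λ t → 2 ^ (w * ℓ) * t * e) (trans (cong (p ^_) ℓ²≡) (sym (^-*-assoc p Q (w * ℓ)))) ⟩
      2 ^ (w * ℓ) * (p ^ Q) ^ (w * ℓ) * e      ≡⟨ cong (_* e) (^-distribʳ-* (w * ℓ) 2 (p ^ Q)) ⟨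
      (2 * p ^ Q) ^ (w * ℓ) * e                ≤⟨ *-monoˡ-≤ e (^-monoˡ-≤ (w * ℓ) (2p^Q≤Q^Q p)) ⟩
      (Q ^ Q) ^ (w * ℓ) * e                    ≡⟨ cong (_* e) (trans (^-*-assoc Q Q (w * ℓ)) (cong (Q ^_) (sym ℓ²≡))) ⟩
      Q ^ (ℓ * ℓ) * e                          ≡⟨ cong (λ t → Q ^ t * e) (length-rectangle vw) ⟨
      Q ^ length (rectangle vw) * e            ≤⟨ E-allTrue-≤ n (unique vw∈) ⟩
      p ^ length (rectangle vw) * W            ≡⟨ cong (λ t → p ^ t * W) (length-rectangle vw) ⟩
      p ^ (ℓ * ℓ) * W                          ∎)
      where
      open ≤-Reasoning
      e = E n (allTrue (rectangle vw))
      ℓ²≡ : ℓ * ℓ ≡ Q * (w * ℓ)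
      ℓ²≡ = trans (cong (_* ℓ) ℓ≡) (*-assoc Q w ℓ)
      unique : vw ∈ rectangles ℓ → Unique (rectangle vw)
      unique vw∈ = let v∈ , w∈ = ∈-cartesianProduct⁻ (sides ℓ) (sides ℓ) vw∈ in rectangle-unique v∈ w∈

    -- The union bound over at most (N^ℓ)² rectangles: the expected number of all-true ones is at
    -- most 1 / (4 · 4^v).
    E-count : E n (count ℓ) * 2 ^ (2 + 2 * v) ≤ W
    E-count = *-cancelˡ-≤ (2 ^ (2 * r * ℓ)) {{m^n≢0 2 (2 * r * ℓ)}} (begin
      2 ^ (2 * r * ℓ) * (c * 2 ^ (2 + 2 * v))  ≡⟨ solve 3 (λ a b c → a :* (b :* c) := b :* (a :* c)) refl (2 ^ (2 * r * ℓ)) c (2 ^ (2 + 2 * v)) ⟩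
      c * (2 ^ (2 * r * ℓ) * 2 ^ (2 + 2 * v))  ≡⟨ cong (c *_) (^-distribˡ-+-* 2 (2 * r * ℓ) (2 + 2 * v)) ⟨
      c * 2 ^ (2 * r * ℓ + (2 + 2 * v))        ≤⟨ *-monoʳ-≤ c (^-monoʳ-≤ 2 w-large) ⟩
      c * 2 ^ (w * ℓ)                          ≡⟨ cong (_* 2 ^ (w * ℓ)) (E-∑ n (rectangles ℓ) (λ vw → allTrue (rectangle vw))) ⟩
      ∑ (rectangles ℓ) (λ vw → E n (allTrue (rectangle vw))) * 2 ^ (w * ℓ)
        ≡⟨ ∑-*ʳ (rectangles ℓ) _ (2 ^ (w * ℓ)) ⟨
      ∑ (rectangles ℓ) (λ vw → E n (allTrue (rectangle vw)) * 2 ^ (w * ℓ))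
        ≤⟨ ∑-≤-length* (rectangles ℓ) _ E-rectangle ⟩
      length (rectangles ℓ) * W                ≡⟨ cong (_* W) (length-cartesianProductWith _,_ (sides ℓ) (sides ℓ)) ⟩
      length (sides ℓ) * length (sides ℓ) * W  ≤⟨ *-monoˡ-≤ W (*-mono-≤ (length-sides ℓ) (length-sides ℓ)) ⟩
      N ^ ℓ * N ^ ℓ * W                        ≡⟨ cong (_* W) N^2ℓ ⟩
      2 ^ (2 * r * ℓ) * W                      ∎)
      where
      open ≤-Reasoning
      c = E n (count ℓ)
      N^2ℓ : N ^ ℓ * N ^ ℓ ≡ 2 ^ (2 * r * ℓ)
      N^2ℓ = trans (cong₂ _*_ (^-*-assoc 2 r ℓ) (^-*-assoc 2 r ℓ)) (trans (sym (^-distribˡ-+-* 2 (r * ℓ) (r * ℓ)))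
        (cong (2 ^_) (solve 2 (λ r l → r :* l :+ r :* l := con 2 :* r :* l) refl r ℓ)))

    threshold-value : 4 * 4 ^ v * 2 ^ z ≡ N
    threshold-value = trans (cong (λ t → 4 * t * 2 ^ z) (^-*-assoc 2 2 v))
      (trans (cong (_* 2 ^ z) (sym (^-distribˡ-+-* 2 2 (2 * v))))
      (trans (*-comm (2 ^ (2 + 2 * v)) (2 ^ z)) (trans (sym (^-distribˡ-+-* 2 z (2 + 2 * v))) (cong (2 ^_) (sym r≡)))))

    -- One comparison with `size` enforces both requirements. As `size` is at most N², a single
    -- all-true rectangle already makes the penalty too large, and the second term is the threshold
    -- of `rich-rows` for d = 2^z.
    penalty : Colours → ℕ
    penalty χ = count ℓ χ * (N * N) + 2 * (N * 2 ^ z)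

    -- In units of N² W / (4 · 4^v), the rectangles contribute at most 1 and the constant term
    -- exactly 2, while `E-size` provides at least 4.
    E-penalty : 4 * 4 ^ v * E n penalty ≤ 3 * (N * N * W)
    E-penalty = begin
      4 * 4 ^ v * E n penalty
        ≡⟨ cong (4 * 4 ^ v *_) (trans (E-+ n (λ χ → count ℓ χ * (N * N)) _)
             (cong₂ _+_ (E-*ʳ n (count ℓ) (N * N)) (E-const n (2 * (N * 2 ^ z))))) ⟩
      4 * 4 ^ v * (c * (N * N) + 2 * (N * 2 ^ z) * W)
        ≡⟨ solve 5 (λ f c N z W → f :* (c :* (N :* N) :+ con 2 :* (N :* z) :* W)
                                     := N :* N :* (c :* f) :+ con 2 :* (N :* (f :* z) :* W)) refl (4 * 4 ^ v) c N (2 ^ z) W ⟩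
      N * N * (c * (4 * 4 ^ v)) + 2 * (N * (4 * 4 ^ v * 2 ^ z) * W)
        ≡⟨ cong₂ (λ s t → N * N * (c * s) + 2 * (N * t * W)) 4*4^v threshold-value ⟩
      N * N * (c * 2 ^ (2 + 2 * v)) + 2 * (N * N * W)
        ≤⟨ +-monoˡ-≤ (2 * (N * N * W)) (*-monoʳ-≤ (N * N) E-count) ⟩
      N * N * W + 2 * (N * N * W)  ∎
      where
      open ≤-Reasoning
      c = E n (count ℓ)
      4*4^v : 4 * 4 ^ v ≡ 2 ^ (2 + 2 * v)
      4*4^v = trans (cong (4 *_) (^-*-assoc 2 2 v)) (sym (^-distribˡ-+-* 2 2 (2 * v)))

    E-penalty<E-size : E n penalty < E n size
    E-penalty<E-size = *-cancelˡ-< (4 * 4 ^ v) _ _ (begin-strict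
      4 * 4 ^ v * E n penalty        ≤⟨ E-penalty ⟩
      3 * (N * N * W)                <⟨ m<n+m (3 * (N * N * W)) positive ⟩
      4 * (N * N * W)                ≤⟨ *-monoʳ-≤ 4 E-size ⟩
      4 * (4 ^ v * E n size)         ≡⟨ *-assoc 4 (4 ^ v) (E n size) ⟨
      4 * 4 ^ v * E n size           ∎)
      where
      open ≤-Reasoning
      positive : 0 < N * N * W
      positive = *-mono-≤ (*-mono-≤ (m^n>0 2 r) (m^n>0 2 r)) (m^n>0 Q n)

    colouring : ∃[ χ ] RectangleFree ℓ χ × 2 ^ z ≤ length (richRows (2 ^ z) χ)
    colouring = let χ , lt = E-<⇒∃ n size penalty E-penalty<E-size in
      χ , count≡0⇒RectangleFree ℓ χ (none χ lt)
        , rich-rows (2 ^ z) χ (≤-<-trans (m≤n+m _ (count ℓ χ * (N * N))) lt)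
      where
      none : ∀ χ → penalty χ < size χ → count ℓ χ ≡ 0
      none χ lt with count ℓ χ
      ... | zero  = refl
      ... | suc c = contradiction (<-≤-trans lt (size≤N² χ)) (≤⇒≯ (begin
        N * N                                ≤⟨ m≤m+n (N * N) (c * (N * N)) ⟩
        suc c * (N * N)                      ≤⟨ m≤m+n (suc c * (N * N)) _ ⟩
        suc c * (N * N) + 2 * (N * 2 ^ z)    ∎))
        where open ≤-Reasoning

-- Order on pairs, and the grid pattern.

module _ {m n : ℕ} where

  combine-≤⇒≤ : ∀ {i j : Fin m} {k l : Fin n} → combine i k Fin.≤ combine j l → i Fin.≤ j
  combine-≤⇒≤ {k = k} {l} le = ≮⇒≥ λ j<i → <⇒≱ (Fin.combine-monoˡ-< l k j<i) le

  combine-monoʳ-≤ : ∀ (i : Fin m) {k l : Fin n} → k Fin.≤ l → combine i k Fin.≤ combine i l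
  combine-monoʳ-≤ i {k} {l} le = subst₂ _≤_ (sym (Fin.toℕ-combine i k)) (sym (Fin.toℕ-combine i l)) (+-monoʳ-≤ (n * toℕ i) le)

  combine-monoʳ-< : ∀ (i : Fin m) {k l : Fin n} → k Fin.< l → combine i k Fin.< combine i l
  combine-monoʳ-< i {k} {l} lt = subst₂ _<_ (sym (Fin.toℕ-combine i k)) (sym (Fin.toℕ-combine i l)) (+-monoʳ-< (n * toℕ i) lt)

  combine-cancelˡ-≤ : ∀ (i : Fin m) {k l : Fin n} → combine i k Fin.≤ combine i l → k Fin.≤ l
  combine-cancelˡ-≤ i le = ≮⇒≥ λ l<k → <⇒≱ (combine-monoʳ-< i l<k) le

  combine-cancelˡ-< : ∀ (i : Fin m) {k l : Fin n} → combine i k Fin.< combine i l → k Fin.< l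
  combine-cancelˡ-< i lt = ≰⇒> λ l≤k → <⇒≱ lt (combine-monoʳ-≤ i l≤k)

-- Position block `a` and value block `b` share exactly one point. The reversal by `opposite` makes
-- the values in a value block decrease along positions; since ties sort increasingly, points of one
-- value block must then have different columns.
grid : ∀ ℓ → Permutation′ (ℓ * ℓ)
grid ℓ = permutation to from to∘from from∘to
  where
  to from : Fin (ℓ * ℓ) → Fin (ℓ * ℓ)
  to x   = let a , b = remQuot {ℓ} ℓ x in combine b (opposite a)
  from y = let b , a = remQuot {ℓ} ℓ y in combine (opposite a) b
  to∘from : ∀ y → to (from y) ≡ y
  to∘from y = let b , a = remQuot {ℓ} ℓ y in trans
    (cong (λ (a , b) → combine b (opposite a)) (Fin.remQuot-combine (opposite a) b))
    (trans (cong (combine b) (Fin.opposite-involutive a)) (Fin.combine-remQuot {ℓ} ℓ y))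
  from∘to : ∀ x → from (to x) ≡ x
  from∘to x = let a , b = remQuot {ℓ} ℓ x in trans
    (cong (λ (b , a) → combine (opposite a) b) (Fin.remQuot-combine b (opposite a)))
    (trans (cong (λ t → combine t b) (Fin.opposite-involutive a)) (Fin.combine-remQuot {ℓ} ℓ x))

grid-combine : ∀ ℓ (a b : Fin ℓ) → grid ℓ ⟨$⟩ʳ combine a b ≡ combine b (opposite a)
grid-combine ℓ a b = cong (λ (a , b) → combine b (opposite a)) (Fin.remQuot-combine a b)

-- One leading maximum confines an occurrence to a single diagonal block; further ones pad the
-- pattern to a prescribed length.
maximaThen : ∀ {m} e → Permutation′ m → Permutation′ (e + m)
maximaThen         zero    π = π
maximaThen {m} (suc e) π = insert zero (Fin.fromℕ (e + m)) (maximaThen e π)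

occurrence-tail : ∀ {k n} {σ : Permutation′ n} {π : Permutation′ k} {y x} →
  Occurrence (insert zero y π) σ x → Occurrence π σ (x ∘ suc)
occurrence-tail {y = y} (occurrence inc same) = occurrence
  (λ i j i<j → inc (suc i) (suc j) (s≤s i<j))
  (λ i j → mk⇔
    (λ lt → ≰⇒> λ πj≤πi → <⇒≱ (Equivalence.to (same (suc i) (suc j)) lt) (Fin.punchIn-mono-≤ y _ _ πj≤πi))
    (λ lt → Equivalence.from (same (suc i) (suc j)) (punchIn-mono-< y lt)))

occurrence-drop : ∀ {k n} {σ : Permutation′ n} {π : Permutation′ k} e {x} →
  Occurrence (maximaThen e π) σ x → Occurrence π σ (x ∘ (e ↑ʳ_))
occurrence-drop zero    o = o
occurrence-drop {σ = σ} (suc e) o = occurrence-drop {σ = σ} e (occurrence-tail {σ = σ} o)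

avoids-resp-≈ : ∀ {k n} {π : Permutation′ k} {σ τ : Permutation′ n} → σ ≈ τ → σ Avoids π → τ Avoids π
avoids-resp-≈ {σ = σ} {τ} σ≈τ avoids (x , occurrence inc same) = avoids (x , occurrence inc
  λ i j → subst₂ (λ a b → (a Fin.< b) ⇔ _) (sym (σ≈τ (x i))) (sym (σ≈τ (x j))) (same i j))

avoiding-complete : ∀ {k n} {π : Permutation′ k} {σ : Permutation′ n} → σ Avoids π → Any (σ ≈_) (avoidingPermutations π n)
avoiding-complete {π = π} {σ} avoids = let τ , τ∈ , σ≈τ = find (permutations-complete σ) in
  lose (∈-filter⁺ (λ σ → ¬? (σ contains? π)) τ∈ (avoids-resp-≈ {σ = σ} {τ} σ≈τ avoids)) σ≈τ

opposite-antitone-≤ : ∀ {n} {i j : Fin n} → i Fin.≤ j → opposite j Fin.≤ opposite i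
opposite-antitone-≤ {n} {i} {j} i≤j = subst₂ _≤_ (sym (Fin.opposite-prop j)) (sym (Fin.opposite-prop i)) (∸-monoʳ-≤ n (s≤s i≤j))

opposite-antitone-< : ∀ {n} {i j : Fin n} → i Fin.< j → opposite j Fin.< opposite i
opposite-antitone-< {n} {i} {j} i<j = subst₂ _<_ (sym (Fin.opposite-prop j)) (sym (Fin.opposite-prop i))
  (∸-monoʳ-< (s≤s i<j) (Fin.toℕ<n j))

-- From an occurrence of the grid to an all-true rectangle.

module _ (r ℓ : ℕ) {first last : Fin ℓ} (first≤ : ∀ (i : Fin ℓ) → first Fin.≤ i)
         (≤last : ∀ (i : Fin ℓ) → i Fin.≤ last) (first<last : first Fin.< last) where

  open Colouring r using (N; Colours; Present; RectangleFree)

  -- A common midpoint `a i` splits the rows of position block `i`, and `b j` splits the columns of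
  -- value block `j`. The entry at (i , j) lies in both ranges, so its presence makes the pair (a i
  -- , b j) true. Each midpoint lies within its block's range and strictly above its lower end, so
  -- the midpoints increase from block to block.
  grid-rectangle : ∀ (row col : Fin (ℓ * ℓ) → ℕ) →
    (∀ {i j} → i Fin.< j → row i < row j) →
    (∀ {i j} → grid ℓ ⟨$⟩ʳ i Fin.< grid ℓ ⟨$⟩ʳ j → col i ≤ col j) →
    (∀ {i j} → j Fin.< i → grid ℓ ⟨$⟩ʳ i Fin.< grid ℓ ⟨$⟩ʳ j → col i < col j) →
    (∀ i → row i < N) → (∀ i → col i < N) →
    ∀ χ → RectangleFree ℓ χ → ¬ (∀ i → Present χ (row i) (col i))
  grid-rectangle row col row-< col-≤ col-< row<N col<N χ free present =
    free a b
      (λ {i} {j} i<j → ≤-<-trans (a≤ i) (<-trans (row-< (Fin.combine-monoˡ-< last first i<j)) (<a j)))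
      -- Different value blocks may meet in a common column, so strictness comes from `<b` alone.
      (λ {i} {j} i<j → ≤-<-trans (b≤ i) (≤-<-trans
        (col-≤ (grid-< first i last j (Fin.combine-monoˡ-< (opposite first) (opposite last) i<j))) (<b j)))
      (λ i → ≤-<-trans (a≤ i) (row<N (combine i last)))
      (λ j → ≤-<-trans (b≤ j) (col<N (combine first j)))
      (λ i j → present (combine i j)
        (a∈ i (row-≤ (combine-monoʳ-≤ i (first≤ j))) (row-≤ (combine-monoʳ-≤ i (≤last j))))
        (b∈ j (col-≤′ last i j (opposite-antitone-≤ (≤last i))) (col-≤′ i first j (opposite-antitone-≤ (first≤ i)))))
    where
    row-≤ : ∀ {i j} → i Fin.≤ j → row i ≤ row j
    row-≤ {i} {j} i≤j with m≤n⇒m<n∨m≡n i≤j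
    ... | inj₁ i<j = <⇒≤ (row-< i<j)
    ... | inj₂ i≡j = ≤-reflexive (cong row (Fin.toℕ-injective i≡j))
    grid-< : ∀ a b a′ b′ → combine b (opposite a) Fin.< combine b′ (opposite a′) →
             grid ℓ ⟨$⟩ʳ combine a b Fin.< grid ℓ ⟨$⟩ʳ combine a′ b′
    grid-< a b a′ b′ = subst₂ Fin._<_ (sym (grid-combine ℓ a b)) (sym (grid-combine ℓ a′ b′))
    col-≤′ : ∀ a a′ b → opposite a Fin.≤ opposite a′ → col (combine a b) ≤ col (combine a′ b)
    col-≤′ a a′ b le with m≤n⇒m<n∨m≡n le
    ... | inj₁ lt = col-≤ (grid-< a b a′ b (combine-monoʳ-< b lt))
    ... | inj₂ eq = ≤-reflexive (cong (λ a → col (combine a b)) (trans (sym (Fin.opposite-involutive a))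
                      (trans (cong opposite (Fin.toℕ-injective eq)) (Fin.opposite-involutive a′))))
    Cut : ℕ → ℕ → ℕ → Set
    Cut x y m = x < m × m ≤ y × (∀ {z} → x ≤ z → z ≤ y → m ∈ cuts r 0 z)
    A : ∀ i → ∃ (Cut (row (combine i first)) (row (combine i last)))
    A i = common-cut r z≤n (row-< (combine-monoʳ-< i first<last)) (row<N (combine i last))
    B : ∀ j → ∃ (Cut (col (combine last j)) (col (combine first j)))
    B j = common-cut r z≤n (col-< (Fin.combine-monoˡ-< j j first<last)
      (grid-< last j first j (combine-monoʳ-< j (opposite-antitone-< first<last)))) (col<N (combine first j))
    a b : Fin ℓ → ℕ
    a = proj₁ ∘ A
    b = proj₁ ∘ B
    <a : ∀ i → row (combine i first) < a i
    <a = proj₁ ∘ proj₂ ∘ A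
    <b : ∀ j → col (combine last j) < b j
    <b = proj₁ ∘ proj₂ ∘ B
    a≤ : ∀ i → a i ≤ row (combine i last)
    a≤ = proj₁ ∘ proj₂ ∘ proj₂ ∘ A
    b≤ : ∀ j → b j ≤ col (combine first j)
    b≤ = proj₁ ∘ proj₂ ∘ proj₂ ∘ B
    a∈ : ∀ i {z} → row (combine i first) ≤ z → z ≤ row (combine i last) → a i ∈ cuts r 0 z
    a∈ i = proj₂ (proj₂ (proj₂ (A i)))
    b∈ : ∀ j {z} → col (combine last j) ≤ z → z ≤ col (combine first j) → b j ∈ cuts r 0 z
    b∈ j = proj₂ (proj₂ (proj₂ (B j)))

  -- Words of entries, their permutations and their codes.

  module Words {s t h d e : ℕ} .{{_ : NonZero h}} (N≡ : N ≡ s * h) (χ : Colours) (free : RectangleFree ℓ χ)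
               (ρ : Fin s → Fin N) (ρ-< : ∀ {i j : Fin s} → i Fin.< j → ρ i Fin.< ρ j)
               (rich : ∀ i → d ≤ length (Colouring.columns r χ (toℕ (ρ i)))) where

    open Colouring r using (columns; ∈-columns)

    private
      n : ℕ
      n = t * s

    block : Fin n → Fin t
    block = quotient {t} s

    offset : Fin n → Fin s
    offset = remainder {t} s

    combine-block-offset : ∀ p → combine (block p) (offset p) ≡ p
    combine-block-offset = Fin.combine-remQuot {t} s

    candidates : Vec (List (Fin N)) n
    candidates = tabulate λ p → columns χ (toℕ (ρ (offset p)))

    lookup-candidates : ∀ p → lookup candidates p ≡ columns χ (toℕ (ρ (offset p)))
    lookup-candidates = lookup∘tabulate λ p → columns χ (toℕ (ρ (offset p)))

    words : List (Vec (Fin N) n)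
    words = choices candidates

    length-words : d ^ n ≤ length words
    length-words = length-choices-≥ candidates λ p → ≤-trans (rich (offset p)) (≤-reflexive (cong length (sym (lookup-candidates p))))

    words-unique : Unique words
    words-unique = choices-unique candidates λ p → subst Unique (sym (lookup-candidates p))
      (Unique.filter⁺ _ (Unique.allFin⁺ N))

    -- The column in the block-diagonal matrix made of `t` copies of the chosen rows, each copy N
    -- columns wide.
    key : Vec (Fin N) n → Fin n → ℕ
    key w p = toℕ (combine (block p) (lookup w p))

    key-injective : ∀ {w w′} → (∀ p → key w p ≡ key w′ p) → w ≡ w′
    key-injective {w} {w′} eq = trans (sym (tabulate∘lookup w)) (trans
      (tabulate-cong λ p → Fin.combine-injectiveʳ (block p) (lookup w p) (block p) (lookup w′ p) (Fin.toℕ-injective (eq p)))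
      (tabulate∘lookup w′))

    module _ {w} (w∈ : w ∈ words) {σ : Permutation′ n} (sorts : Sorts σ (key w)) where

      avoids : σ Avoids maximaThen (suc e) (grid ℓ)
      avoids (x , occ@(occurrence inc same)) = grid-rectangle row col row-< col-≤ col-<
        (λ i → Fin.toℕ<n (ρ (offset (x′ i)))) (λ i → Fin.toℕ<n (lookup w (x′ i))) χ free present
        where
        x′ : Fin (ℓ * ℓ) → Fin n
        x′ = x ∘ (suc e ↑ʳ_)
        occ′ : Occurrence (grid ℓ) σ x′
        occ′ = occurrence-drop {σ = σ} (suc e) occ
        same-block : ∀ i → block (x i) ≡ block (x zero)
        same-block zero    = refl
        -- The first entry is the maximum, so smaller values keep the later entries out of later
        -- blocks, while larger positions keep them out of earlier ones.
        same-block (suc i) = Fin.≤-antisym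
          (combine-≤⇒≤ (≮⇒≥ λ lt → <⇒≱ (Equivalence.to (same zero (suc i)) (sorts (inj₁ lt)))
            (Fin.≤fromℕ ((maximaThen (suc e) (grid ℓ)) ⟨$⟩ʳ suc i))))
          (combine-≤⇒≤ {k = offset (x zero)} {l = offset (x (suc i))}
            (subst₂ Fin._≤_ (sym (combine-block-offset (x zero))) (sym (combine-block-offset (x (suc i)))) (<⇒≤ (inc zero (suc i) z<s))))
        in-block : ∀ i → block (x′ i) ≡ block (x zero)
        in-block i = same-block (suc e ↑ʳ i)
        row col : Fin (ℓ * ℓ) → ℕ
        row i = toℕ (ρ (offset (x′ i)))
        col i = toℕ (lookup w (x′ i))
        position≡ : ∀ i → x′ i ≡ combine (block (x zero)) (offset (x′ i))
        position≡ i = trans (sym (combine-block-offset (x′ i))) (cong (λ b → combine b (offset (x′ i))) (in-block i))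
        key≡ : ∀ i → key w (x′ i) ≡ toℕ (combine (block (x zero)) (lookup w (x′ i)))
        key≡ i = cong (λ b → toℕ (combine b (lookup w (x′ i)))) (in-block i)
        row-< : ∀ {i j} → i Fin.< j → row i < row j
        row-< {i} {j} i<j = ρ-< (combine-cancelˡ-< (block (x zero))
          (subst₂ Fin._<_ (position≡ i) (position≡ j) (Occurrence.increasing occ′ i j i<j)))
        σ-< : ∀ {i j} → grid ℓ ⟨$⟩ʳ i Fin.< grid ℓ ⟨$⟩ʳ j → σ ⟨$⟩ʳ x′ i Fin.< σ ⟨$⟩ʳ x′ j
        σ-< {i} {j} = Equivalence.from (Occurrence.same-order occ′ i j)
        col-≤ : ∀ {i j} → grid ℓ ⟨$⟩ʳ i Fin.< grid ℓ ⟨$⟩ʳ j → col i ≤ col j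
        col-≤ {i} {j} lt = combine-cancelˡ-≤ (block (x zero))
          (subst₂ _≤_ (key≡ i) (key≡ j) (sorts⇒≤ {σ = σ} {key = key w} sorts (σ-< lt)))
        col-< : ∀ {i j} → j Fin.< i → grid ℓ ⟨$⟩ʳ i Fin.< grid ℓ ⟨$⟩ʳ j → col i < col j
        col-< {i} {j} j<i lt = combine-cancelˡ-< (block (x zero))
          (subst₂ _<_ (key≡ i) (key≡ j) (sorts⇒< {σ = σ} {key = key w} sorts (Occurrence.increasing occ′ j i j<i) (σ-< lt)))
        present : ∀ i → Present χ (row i) (col i)
        present i = ∈-columns χ _ (subst (lookup w (x′ i) ∈_) (lookup-candidates (x′ i)) (∈-choices⁻ candidates w∈ (x′ i)))

    -- The keys are divided by `h`: the quotients, listed in the order of `σ`, form a monotone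
    -- sequence with at most 4^n possibilities, and the remainders have h^n.
    Code : Set
    Code = Vec ℕ n × Vec (Fin h) n × Permutation′ n

    Encodes : Vec (Fin N) n → Code → Set
    Encodes w (q , b , σ) = ∀ p → key w p ≡ toℕ (lookup b p) + lookup q (σ ⟨$⟩ʳ p) * h

    codes : List Code
    codes = cartesianProduct (monotone n n)
      (cartesianProduct (choices (replicate n (allFin h))) (avoidingPermutations (maximaThen (suc e) (grid ℓ)) n))

    length-codes : length codes ≤ 2 ^ (n + n) * (h ^ n * S (maximaThen (suc e) (grid ℓ)) n)
    length-codes = begin
      length codes ≡⟨ trans (length-cartesianProductWith _,_ (monotone n n) _)
                        (cong (length (monotone n n) *_) (length-cartesianProductWith _,_ (choices (replicate n (allFin h)))
                          (avoidingPermutations (maximaThen (suc e) (grid ℓ)) n))) ⟩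
      length (monotone n n) * (length (choices (replicate n (allFin h))) * S (maximaThen (suc e) (grid ℓ)) n)
        ≤⟨ *-mono-≤ (length-monotone n n) (*-monoˡ-≤ (S (maximaThen (suc e) (grid ℓ)) n) (length-choices-≤ (replicate n (allFin h))
             λ i → ≤-reflexive (trans (cong length (lookup-replicate i (allFin h))) (length-allFin h)))) ⟩
      2 ^ (n + n) * (h ^ n * S (maximaThen (suc e) (grid ℓ)) n) ∎
      where open ≤-Reasoning

    encode : ∀ {w} → w ∈ words → Any (Encodes w) codes
    encode {w} w∈ = Any.map (λ { {q , c , τ} (q≡ , b≡ , σ≈τ) → correct {q} {c} {τ} q≡ b≡ σ≈τ })
      (Any.cartesianProduct⁺
        (monotone-complete n n g (λ le → /-monoˡ-≤ h (sorts⇒monotone {σ = σ} {key = key w} sorts le)) g≤)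
        (Any.cartesianProduct⁺ b∈ (avoiding-complete {π = maximaThen (suc e) (grid ℓ)} {σ = σ} (avoids w∈ sorts))))
      where
      σ : Permutation′ n
      σ = proj₁ (sorting n (key w))
      sorts : Sorts σ (key w)
      sorts = proj₂ (sorting n (key w))
      g : Fin n → ℕ
      g y = key w (σ ⟨$⟩ˡ y) / h
      -- The t N columns form exactly `n` classes of width `h`, so the quotients stay below `n`.
      tN≡nh : t * N ≡ n * h
      tN≡nh = trans (cong (t *_) N≡) (sym (*-assoc t s h))
      g≤ : ∀ y → g y ≤ n
      g≤ y = <⇒≤ (m<n*o⇒m/o<n (subst (key w (σ ⟨$⟩ˡ y) <_) tN≡nh (Fin.toℕ<n _)))
      b : Vec (Fin h) n
      b = tabulate λ p → key w p mod h
      b∈ : b ∈ choices (replicate n (allFin h))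
      b∈ = ∈-choices⁺ (replicate n (allFin h)) b λ i → subst (lookup b i ∈_) (sym (lookup-replicate i (allFin h))) (∈-allFin (lookup b i))
      correct : ∀ {q c τ} → (∀ y → lookup q y ≡ g y) → b ≡ c → σ ≈ τ → Encodes w (q , c , τ)
      correct {q} {c} {τ} q≡ refl σ≈τ p = trans (m≡m%n+[m/n]*n (key w p) h) (cong₂ (λ a c → a + c * h)
        (sym (trans (cong toℕ (lookup∘tabulate (λ p → key w p mod h) p)) (Fin.toℕ-fromℕ< _)))
        (sym (trans (q≡ (τ ⟨$⟩ʳ p)) (cong (λ y → key w y / h) (trans (cong (σ ⟨$⟩ˡ_) (sym (σ≈τ p))) (inverseˡ σ))))))

    avoiding-bound : d ^ n ≤ 2 ^ (n + n) * (h ^ n * S (maximaThen (suc e) (grid ℓ)) n)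
    avoiding-bound = ≤-trans length-words (≤-trans
      (length-≤-codes {R = Encodes} words-unique encode λ {_} {_} {y} c c′ → key-injective λ p → trans (c p) (sym (c′ p)))
      length-codes)

-- Growth of the number of avoiders, with explicit parameters.

module _ {N : ℕ} {P : Fin N → Set} (P? : ∀ i → Dec (P i)) {s : ℕ}
         (enough : s ≤ length (filter P? (allFin N))) where

  enumerate : Fin s → Fin N
  enumerate i = List.lookup (filter P? (allFin N)) (inject≤ i enough)

  enumerate-< : ∀ {i j} → i Fin.< j → enumerate i Fin.< enumerate j
  enumerate-< {i} {j} i<j = AllPairs-lookup (AllPairs.filter⁺ P? (AllPairs.tabulate⁺-< {f = λ i → i} λ i<j → i<j))
    (subst₂ _<_ (sym (Fin.toℕ-inject≤ i enough)) (sym (Fin.toℕ-inject≤ j enough)) i<j)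

  enumerate-satisfies : ∀ i → P (enumerate i)
  enumerate-satisfies i = proj₂ (∈-filter⁻ P? {xs = allFin N} (∈-lookup (inject≤ i enough)))

-- This is 25 v · 144 v. Being the square of 60 v, it gives the grid (60 v)^4 points, which is where
-- the exponent 1/4 originates.
side-length : ℕ → ℕ
side-length v = 60 * v * (60 * v)

-- Exponents of 2 per point: of the `z` from the choice of entries, the lattice path costs 2 and the
-- remainders cost `u`, which leaves at least `v`.
cancel-powers : ∀ u v z n x → 2 + u + v ≤ z → (2 ^ z) ^ n ≤ 2 ^ (n + n) * ((2 ^ u) ^ n * x) → (2 ^ v) ^ n ≤ x
cancel-powers u v z n x z-large bound = *-cancelˡ-≤ (2 ^ (n + n) * (2 ^ u) ^ n)
  {{m*n≢0 (2 ^ (n + n)) ((2 ^ u) ^ n) {{m^n≢0 2 (n + n)}} {{m^n≢0 (2 ^ u) n {{m^n≢0 2 u}}}}}} (begin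
  2 ^ (n + n) * (2 ^ u) ^ n * (2 ^ v) ^ n
    ≡⟨ cong₂ _*_ (cong₂ _*_ (cong (2 ^_) (solve 1 (λ n → n :+ n := con 2 :* n) refl n)) (^-*-assoc 2 u n)) (^-*-assoc 2 v n) ⟩
  2 ^ (2 * n) * 2 ^ (u * n) * 2 ^ (v * n)
    ≡⟨ trans (cong (_* 2 ^ (v * n)) (sym (^-distribˡ-+-* 2 (2 * n) (u * n)))) (sym (^-distribˡ-+-* 2 (2 * n + u * n) (v * n))) ⟩
  2 ^ (2 * n + u * n + v * n)
    ≡⟨ cong (2 ^_) (solve 3 (λ u v n → con 2 :* n :+ u :* n :+ v :* n := (con 2 :+ u :+ v) :* n) refl u v n) ⟩
  2 ^ ((2 + u + v) * n)           ≤⟨ ^-monoʳ-≤ 2 (*-monoˡ-≤ n z-large) ⟩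
  2 ^ (z * n)                     ≡⟨ ^-*-assoc 2 z n ⟨
  (2 ^ z) ^ n                     ≤⟨ bound ⟩
  2 ^ (n + n) * ((2 ^ u) ^ n * x) ≡⟨ *-assoc (2 ^ (n + n)) ((2 ^ u) ^ n) x ⟨
  2 ^ (n + n) * (2 ^ u) ^ n * x   ∎)
  where open ≤-Reasoning

module _ {r u v z ℓ : ℕ} (r≡ : r ≡ z + u) (z-large : 2 + u + v ≤ z) (2≤ℓ : 2 ≤ ℓ)
         {χ : Colouring.Colours r} (free : Colouring.RectangleFree r ℓ χ)
         (enough : 2 ^ z ≤ length (Colouring.richRows r (2 ^ z) χ)) where

  private
    instance
      h≢0 : NonZero (2 ^ u)
      h≢0 = m^n≢0 2 u
    first<ℓ : 0 < ℓ
    first<ℓ = ≤-trans (s≤s z≤n) 2≤ℓ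
    last<ℓ : pred ℓ < ℓ
    last<ℓ = ≤-reflexive (suc-pred ℓ {{>-nonZero first<ℓ}})
    first≡0 : toℕ (fromℕ< first<ℓ) ≡ 0
    first≡0 = Fin.toℕ-fromℕ< first<ℓ
    last≡ : toℕ (fromℕ< last<ℓ) ≡ pred ℓ
    last≡ = Fin.toℕ-fromℕ< last<ℓ

  growth-of-colouring : ∀ e t → (2 ^ v) ^ (t * 2 ^ z) ≤ S (maximaThen (suc e) (grid ℓ)) (t * 2 ^ z)
  growth-of-colouring e t = cancel-powers u v z (t * 2 ^ z) _ z-large avoiding-bound
    where
    open Words r ℓ {fromℕ< first<ℓ} {fromℕ< last<ℓ}
      (λ i → subst (_≤ toℕ i) (sym first≡0) z≤n)
      (λ i → subst (toℕ i ≤_) (sym last≡) (<⇒≤pred (Fin.toℕ<n i)))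
      (subst₂ _<_ (sym first≡0) (sym last≡) (pred-mono-≤ 2≤ℓ))
      {2 ^ z} {t} {2 ^ u} {2 ^ z} {e} (trans (cong (2 ^_) r≡) (^-distribˡ-+-* 2 z u)) χ free
      (enumerate (Colouring.rich? r (2 ^ z) χ) enough) (enumerate-< (Colouring.rich? r (2 ^ z) χ) enough)
      (enumerate-satisfies (Colouring.rich? r (2 ^ z) χ) enough)
      using (avoiding-bound)

growth : ∀ {r p m u v w z ℓ : ℕ} → u ≡ 2 + 2 * v → 1 ≤ p → suc p ≡ m + m → r * r ≡ suc p * v → ℓ ≡ suc p * w →
  2 * r * ℓ + u ≤ w * ℓ → r ≡ z + u → 2 ≤ ℓ → 2 + u + v ≤ z →
  ∀ e → ∃[ s ] ∀ t → (2 ^ v) ^ (t * suc s) ≤ S (maximaThen (suc e) (grid ℓ)) (t * suc s)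
growth {r} {p} {m} {u} {v} {w} {z} {ℓ} u≡ 1≤p Q-even r²≡ ℓ≡ w-large r≡ 2≤ℓ z-large e =
  case Colouring.Random.colouring r {p} {m} {v} {w} {z} {ℓ} 1≤p Q-even r²≡ ℓ≡
    (subst (λ u → 2 * r * ℓ + u ≤ w * ℓ) u≡ w-large) (trans r≡ (cong (λ u → z + u) u≡)) of λ (χ , free , enough) →
  pred (2 ^ z) , λ t → subst (λ s → (2 ^ v) ^ (t * s) ≤ S (maximaThen (suc e) (grid ℓ)) (t * s))
    (sym (suc-pred (2 ^ z) {{m^n≢0 2 z}})) (growth-of-colouring r≡ z-large 2≤ℓ free enough e t)

-- The constants make r = 12 v exceed twice the exponent 2 + 2 v of the density loss by
-- more than v, with Q = 12 r large enough that all r² pairs are true with probability at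
-- least 4 ^ -v, and ℓ = 25 v Q large enough to beat the (2 ^ r) ^ 2ℓ rectangles.
pattern-growth : ∀ v .{{_ : NonZero v}} e →
  ∃[ s ] ∀ t → (2 ^ v) ^ (t * suc s) ≤ S (maximaThen (suc e) (grid (side-length v))) (t * suc s)
-- Here `z` is r - u = 10 v - 2, where the truncated subtraction is exact because v ≥ 1, and 72 v is
-- half of Q.
pattern-growth v e = growth {12 * v} {pred Q} {72 * v} {2 + 2 * v} {v} {25 * v} {8 * v + (2 * v ∸ 2)} {side-length v}
    refl
    1≤p
    (trans Q≡ (solve 1 (λ v → con 144 :* v := con 72 :* v :+ con 72 :* v) refl v))
    (trans (solve 1 (λ v → con 12 :* v :* (con 12 :* v) := con 144 :* v :* v) refl v) (cong (_* v) (sym Q≡)))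
    (trans (solve 1 (λ v → con 60 :* v :* (con 60 :* v) := con 144 :* v :* (con 25 :* v)) refl v) (cong (_* (25 * v)) (sym Q≡)))
    w-large
    r≡z+u
    (≤-trans (s≤s (s≤s z≤n)) 4≤ℓ)
    z-large
    e
  where
  open ≤-Reasoning
  Q : ℕ
  Q = 144 * v
  2≤60v : 2 ≤ 60 * v
  2≤60v = ≤-trans (s≤s (s≤s z≤n)) (m≤m*n 60 v)
  4≤ℓ : 4 ≤ side-length v
  4≤ℓ = *-mono-≤ 2≤60v 2≤60v
  2≤Q : 2 ≤ Q
  2≤Q = ≤-trans (s≤s (s≤s z≤n)) (m≤m*n 144 v)
  Q≡ : suc (pred Q) ≡ Q
  Q≡ = suc-pred Q {{>-nonZero (≤-trans (s≤s z≤n) 2≤Q)}}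
  1≤p : 1 ≤ pred Q
  1≤p = pred-mono-≤ 2≤Q
  2≤2v : 2 ≤ 2 * v
  2≤2v = m≤m*n 2 v
  w-large : 2 * (12 * v) * side-length v + (2 + 2 * v) ≤ 25 * v * side-length v
  w-large = begin
    2 * (12 * v) * side-length v + (2 + 2 * v)
      ≤⟨ +-monoʳ-≤ (2 * (12 * v) * side-length v) (begin
        2 + 2 * v                ≤⟨ +-monoˡ-≤ (2 * v) 2≤2v ⟩
        2 * v + 2 * v            ≡⟨ solve 1 (λ v → con 2 :* v :+ con 2 :* v := v :* con 4) refl v ⟩
        v * 4                    ≤⟨ *-monoʳ-≤ v 4≤ℓ ⟩
        v * side-length v                    ∎) ⟩
    2 * (12 * v) * side-length v + v * side-length v
      ≡⟨ solve 2 (λ v l → con 2 :* (con 12 :* v) :* l :+ v :* l := con 25 :* v :* l) refl v (side-length v) ⟩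
    25 * v * side-length v             ∎
  r≡z+u : 12 * v ≡ 8 * v + (2 * v ∸ 2) + (2 + 2 * v)
  r≡z+u = trans (solve 1 (λ v → con 12 :* v := con 8 :* v :+ con 2 :* v :+ con 2 :* v) refl v)
    (trans (cong (λ a → 8 * v + a + 2 * v) (sym (m+[n∸m]≡n 2≤2v)))
      (solve 2 (λ v b → con 8 :* v :+ (con 2 :+ b) :+ con 2 :* v := con 8 :* v :+ b :+ (con 2 :+ con 2 :* v)) refl v (2 * v ∸ 2)))
  z-large : 2 + (2 + 2 * v) + v ≤ 8 * v + (2 * v ∸ 2)
  z-large = begin
    2 + (2 + 2 * v) + v          ≤⟨ +-monoˡ-≤ v (+-mono-≤ 2≤2v (+-monoˡ-≤ (2 * v) 2≤2v)) ⟩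
    2 * v + (2 * v + 2 * v) + v  ≡⟨ solve 1 (λ v → con 2 :* v :+ (con 2 :* v :+ con 2 :* v) :+ v := con 7 :* v) refl v ⟩
    7 * v                        ≤⟨ *-monoˡ-≤ v (n≤1+n 7) ⟩
    8 * v                        ≤⟨ m≤m+n (8 * v) _ ⟩
    8 * v + (2 * v ∸ 2)  ∎

-- Rational and real bounds for roots, powers and limits.

fromℕ-+ : ∀ m n → fromℕ (m + n) ≡ fromℕ m ℚ.+ fromℕ n
fromℕ-+ zero    n = sym (ℚ.+-identityˡ (fromℕ n))
fromℕ-+ (suc m) n = trans (fromℕ-suc (m + n)) (trans (cong (1ℚ ℚ.+_) (fromℕ-+ m n))
  (trans (sym (ℚ.+-assoc 1ℚ (fromℕ m) (fromℕ n))) (cong (ℚ._+ fromℕ n) (sym (fromℕ-suc m)))))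

fromℕ-* : ∀ m n → fromℕ (m * n) ≡ fromℕ m ℚ.* fromℕ n
fromℕ-* zero    n = sym (ℚ.*-zeroˡ (fromℕ n))
fromℕ-* (suc m) n = trans (fromℕ-+ n (m * n)) (trans
  (cong₂ ℚ._+_ (sym (ℚ.*-identityˡ (fromℕ n))) (fromℕ-* m n))
  (trans (sym (ℚ.*-distribʳ-+ (fromℕ n) 1ℚ (fromℕ m))) (cong (ℚ._* fromℕ n) (sym (fromℕ-suc m)))))

fromℕ-^ : ∀ m n → fromℕ (m ^ n) ≡ fromℕ m ^ℚ n
fromℕ-^ m zero    = refl
fromℕ-^ m (suc n) = trans (fromℕ-* m (m ^ n)) (cong (fromℕ m ℚ.*_) (fromℕ-^ m n))

fromℕ-mono-≤ : ∀ {m n} → m ≤ n → fromℕ m ℚ.≤ fromℕ n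
fromℕ-mono-≤ {m} {n} m≤n = subst₂ ℚ._≤_ (ℚ.+-identityʳ (fromℕ m))
  (trans (sym (fromℕ-+ m (n ∸ m))) (cong fromℕ (m+[n∸m]≡n m≤n)))
  (ℚ.+-monoʳ-≤ (fromℕ m) (0≤fromℕ (n ∸ m)))

lower-root : ∀ {n k M q} .{{_ : NonZero n}} → k ≤ M ^ n → Lower (root n k) q → q ℚ.< fromℕ M
lower-root {n} {k} {M} k≤ (x , q<x , 0≤x , x^n≤k) = ℚ.<-≤-trans q<x (ℚ.≮⇒≥ λ M<x → ℚ.<-irrefl refl
  (ℚ.<-≤-trans (^-mono-< n (0≤fromℕ M) M<x) (ℚ.≤-trans x^n≤k
    (subst (fromℕ k ℚ.≤_) (fromℕ-^ M n) (fromℕ-mono-≤ k≤)))))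

upper-root : ∀ {n k M q} .{{_ : NonZero n}} → M ^ n ≤ k → Upper (root n k) q → fromℕ M ℚ.< q
upper-root {n} {k} {M} ≤k (x , x<q , 0≤x , k≤x^n) = ℚ.≤-<-trans (ℚ.≮⇒≥ λ x<M → ℚ.<-irrefl refl
  (ℚ.<-≤-trans (^-mono-< n 0≤x x<M) (ℚ.≤-trans
    (subst (ℚ._≤ fromℕ k) (fromℕ-^ M n) (fromℕ-mono-≤ ≤k)) k≤x^n))) x<q

-- For q < q′ < b, locatedness makes `q` a lower bound or `q′` an upper bound of `L`. In the second
-- case ε = b - q′ would eventually push all roots below b, against the bound at arbitrarily large
-- multiples of `suc s`.
lower-limit : ∀ (f : ℕ → ℕ) b s → (∀ t → b ^ (t * suc s) ≤ f (t * suc s)) →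
              ∀ L → (λ n → root (suc n) (f (suc n))) ConvergesTo L → ∀ {q} → q ℚ.< fromℕ b → Lower L q
lower-limit f b s large L limit {q} q<b =
  case ℚ.<-dense q<b of λ (q′ , q<q′ , q′<b) → case located L q<q′ of λ where
    (inj₁ lower) → lower
    (inj₂ upper) → case limit (fromℚ (fromℕ b ℚ.- q′)) (ℚ.<-dense (0<q-p q′<b)) of λ (n₀ , close) →
      -- Index n carries the root of order n + 1, so this index belongs to the length
      -- `suc n₀ * suc s`.
      case proj₂ (close (s + n₀ * suc s) (≤-trans (m≤m*n n₀ (suc s)) (m≤n+m (n₀ * suc s) s))) of
        λ (p , b≤p , a , c , la , c<ε , p<a+c) → contradiction
          (ℚ.<-trans (upper-root {suc n₀ * suc s} {f (suc n₀ * suc s)} {b} (large (suc n₀)) b≤p)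
            (ℚ.<-trans p<a+c (ℚ.+-mono-< (lower<upper L la upper) c<ε)))
          (ℚ.<-irrefl (sym (cancel q′)))
  where
  cancel : ∀ q′ → q′ ℚ.+ (fromℕ b ℚ.- q′) ≡ fromℕ b
  cancel q′ = ℚ-Solver.solve 2 (λ q b → q ℚ-Solver.:+ (b ℚ-Solver.:- q) ℚ-Solver.:= b) refl q′ (fromℕ b)

lower-scaled : ∀ {γ x B q} → 0ℚ ℚ.< γ → (∀ {q} → Lower x q → q ℚ.< B) → Lower (fromℚ γ *ℝ x) q → q ℚ.< γ ℚ.* B
lower-scaled {γ} {x} 0<γ below (a , b , c , d , a<γ , γ<b , lc , ud , corners) =
  -- A bound at the four corners holds throughout the bracket, in particular at (γ , c).
  ℚ.<-trans (lower-between² {a = a} {b} {c} {d} (ℚ.<⇒≤ a<γ) (ℚ.<⇒≤ γ<b) ℚ.≤-refl (ℚ.<⇒≤ (lower<upper x lc ud)) corners)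
    (ℚ.*-monoʳ-<-pos γ {{ℚ.positive 0<γ}} (below lc))

lower-power : ∀ {x v q} → (∀ {q} → Lower x q → q ℚ.< fromℕ v) → Lower (2^ x) q → q ℚ.< fromℕ (2 ^ v)
lower-power {x} {v} below (a , b , la , y , q<y , y-ok) = ℚ.<-≤-trans q<y
  (power-order {a} {suc b} {ℤ.+ v} {1} (below la) y-ok
    (0≤fromℕ (2 ^ v) , ℚ.≤-reflexive (sym (trans (ℚ.*-identityʳ (fromℕ (2 ^ v))) (fromℕ-^ 2 v)))))

bracket : ∀ (F : ℕ → ℕ) {k} n → F 1 < k → k ≤ F (suc n) → ∃[ v ] F (suc v) < k × k ≤ F (suc (suc v))
bracket F     zero    F1<k k≤ = contradiction F1<k (≤⇒≯ k≤)
bracket F {k} (suc n) F1<k k≤ with F (suc n) <? k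
... | yes F<k = n , F<k , k≤
... | no  F≮k = bracket F n F1<k (≮⇒≥ F≮k)

-- Fitting the pattern to a given length.

area : ℕ → ℕ
area v = side-length v * side-length v

m≤m² : ∀ m → m ≤ m * m
m≤m² zero    = z≤n
m≤m² (suc m) = m≤m*n (suc m) (suc m)

n≤area : ∀ n → n ≤ area n
n≤area n = ≤-trans (m≤n*m n 60) (≤-trans (m≤m² (60 * n)) (m≤m² (side-length n)))

-- For v ≥ 1, v + 1 ≤ 2 v; this doubling turns 60 into the 120 whose inverse is the constant `γ`.
area-suc : ∀ v′ → area (suc (suc v′)) ≤ (120 * suc v′) ^ 4
area-suc v′ = ≤-trans (*-mono-≤ (*-mono-≤ le le) (*-mono-≤ le le))
  (≤-reflexive (solve 1 (λ m → m :* m :* (m :* m) := m :* (m :* (m :* (m :* con 1)))) refl (120 * suc v′)))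
  where
  le : 60 * suc (suc v′) ≤ 120 * suc v′
  le = ≤-trans (m≤m+n (60 * suc (suc v′)) (60 * v′)) (≤-reflexive
    (solve 1 (λ v → con 60 :* (con 2 :+ v) :+ con 60 :* v := con 120 :* (con 1 :+ v)) refl v′))

γ : ℚ
γ = ℤ.+ 1 ℚ./ 120

limit-bound : ∀ v .{{_ : NonZero v}} e {k} → k ≤ (120 * v) ^ 4 →
  ∀ L → IsStanleyWilfLimit (maximaThen (suc e) (grid (side-length v))) L → 2^ (fromℚ γ *ℝ root 4 k) ≤ℝ L
limit-bound v e {k} k≤ L limit lower = case pattern-growth v e of λ (s , large) →
  lower-limit (S (maximaThen (suc e) (grid (side-length v)))) (2 ^ v) s large L limit
    (lower-power {fromℚ γ *ℝ root 4 k} {v} (λ l → subst (_ ℚ.<_) scale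
      (lower-scaled {γ} {root 4 k} {fromℕ (120 * v)} (ℚ.positive⁻¹ γ) (lower-root {4} {k} {120 * v} k≤) l)) lower)
  where
  scale : γ ℚ.* fromℕ (120 * v) ≡ fromℕ v
  scale = trans (cong (γ ℚ.*_) (fromℕ-* 120 v)) (trans (sym (ℚ.*-assoc γ (fromℕ 120) (fromℕ v))) (ℚ.*-identityˡ (fromℕ v)))

-- With `P` stated for every length, matching the length equation with `refl` transports the pattern
-- and its property to length `k` together.
grid-at-size : ∀ {k ℓ} e → suc e + ℓ * ℓ ≡ k → (P : ∀ {k} → Permutation′ k → Set₁) →
               P (maximaThen (suc e) (grid ℓ)) → Σ[ π ∈ Permutation′ k ] P π
grid-at-size {ℓ = ℓ} e refl P p = maximaThen (suc e) (grid ℓ) , p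

theorem1 : Σ[ c ∈ ℝ ] 0ℝ <ℝ c ×
    Σ[ k₀ ∈ ℕ ] 1 ≤ k₀ ×
    (∀ k → k₀ ≤ k →
    Σ[ π ∈ Permutation′ k ]
    (∀ L → IsStanleyWilfLimit π L → 2^ (c *ℝ root 4 k) ≤ℝ L))
theorem1 = fromℚ γ , ℚ.<-dense (ℚ.positive⁻¹ γ) , suc (area 1) , s≤s z≤n , λ k k₀≤k →
  -- With v = v′ + 1, area v < k ≤ area (v + 1): the lower bound leaves room for at least one
  -- leading maximum, and the upper one gives k ≤ (120 v)^4.
  let v′ , lo , hi = bracket area k k₀≤k (≤-trans (n≤1+n k) (n≤area (suc k)))
      e = k ∸ suc (area (suc v′)) in
  grid-at-size {ℓ = side-length (suc v′)} e (trans (sym (+-suc e (area (suc v′)))) (m∸n+n≡m lo))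
    (λ π → ∀ L → IsStanleyWilfLimit π L → 2^ (fromℚ γ *ℝ root 4 k) ≤ℝ L)
    (limit-bound (suc v′) e (≤-trans hi (area-suc v′)))
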